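{- Let $k$ and $i$ be integers with $1\le i\le k/2$, $k\equiv 2\pmod 3$ and $i\equiv 0\pmod 3$. Then for all integers $n\ge 0$: (1) if $k-i\equiv 2\pmod 9$, then $S_{k,i}(9n+5)\equiv S_{k,i}(9n+8)\equiv 0\pmod 4$; (2) if $k-i\equiv 5\pmod 9$, then $S_{k,i}(9n+2)\equiv S_{k,i}(9n+8)\equiv 0\pmod 4$; (3) if $k-i\equiv 8\pmod 9$, then $S_{k,i}(9n+2)\equiv S_{k,i}(9n+5)\equiv 0\pmod 4$.
   Context: Write $(a;q)_\infty=\prod_{m\ge 0}(1-aq^m)$, $(a)_\infty=(a;q)_\infty$, and $(a_1,\ldots,a_r;q)_\infty=(a_1;q)_\infty\cdots(a_r;q)_\infty$. For integers $k,i$ with $1\le i\le k/2$, the integers $S_{k,i}(n)$, $n\ge 0$, are given by the generating function $$\sum_{n\ge 0}S_{k,i}(n)q^n=\frac{(-q)_\infty\,(q^i,q^{k-i},q^k;q^k)_\infty}{(q)_\infty}.$$ Combinatorially (an overpartition of $n$ is a partition of $n$ in which the first occurrence of each integer may be overlined): if $i<k/2$, $S_{k,i}(n)$ is the number of overpartitions of $n$ whose non-overlined parts are not congruent to $0,\pm i$ modulo $k$; if $i=k/2$, it is the number of overpartitions of $n$ with no part divisible by $k/2$. -}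

module Defs where

open import Data.Bool.Base using (if_then_else_)
open import Data.Fin.Base using (toℕ)
open import Data.Integer.Base using (ℤ; 0ℤ; 1ℤ; _+_; _-_; _*_; -_)
import Data.Integer.Properties as ℤ
open import Data.Nat.Base as ℕ using (ℕ; zero; suc; _∸_; _<_; _≤_; _≤′_; ≤′-refl; ≤′-step; NonZero)
import Data.Nat.Properties as ℕ
open import Relation.Binary.PropositionalEquality
open import Relation.Nullary.Decidable using (does; dec-false)
import Algebra.Properties.Monoid.Sum ℤ.+-0-monoid as Sum
open Sum using (sum⁺-syntax)

infixl 6 _-ₛ_
infixl 7 _*ₛ_ _/ₛ_
infix  8 -ₛ_
infix  9 q^_

-- Formal power series ∑ f(n) q^n over ℤ; equality of series is _≗_.

Series : Set
Series = ℕ → ℤ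

q^_ : ℕ → Series
(q^ e) n = if does (n ℕ.≟ e) then 1ℤ else 0ℤ

1ₛ : Series
1ₛ = q^ 0

-ₛ_ : Series → Series
(-ₛ f) n = - f n

_-ₛ_ : Series → Series → Series
(f -ₛ g) n = f n - g n

_*ₛ_ : Series → Series → Series
(f *ₛ g) n = ∑[ j ≤ n ] (f (toℕ j) * g (n ∸ toℕ j))

-- Long division by a series g with constant term 1: writing f = f₀ + q f′ and
-- g = 1 + q g′, we have f / g = f₀ + q ((f′ - f₀ g′) / g).  See /ₛ-*ₛ-cancel.

_/ₛ_ : Series → Series → Series
(f /ₛ g) zero    = f 0
(f /ₛ g) (suc n) = ((λ m → f (suc m) - f 0 * g (suc m)) /ₛ g) n

/ₛ-*ₛ-cancel : ∀ f g → g 0 ≡ 1ℤ → (f /ₛ g) *ₛ g ≗ f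
/ₛ-*ₛ-cancel f g g₀≡1 zero = begin
  f 0 * g 0 + 0ℤ  ≡⟨ ℤ.+-identityʳ _ ⟩
  f 0 * g 0       ≡⟨ cong (f 0 *_) g₀≡1 ⟩
  f 0 * 1ℤ        ≡⟨ ℤ.*-identityʳ _ ⟩
  f 0             ∎
  where open ≡-Reasoning
/ₛ-*ₛ-cancel f g g₀≡1 (suc n) = begin
  x + ((f″ /ₛ g) *ₛ g) n  ≡⟨ cong (x +_) (/ₛ-*ₛ-cancel f″ g g₀≡1 n) ⟩
  x + (f (suc n) - x)     ≡⟨ ℤ.+-comm x _ ⟩
  f (suc n) - x + x       ≡⟨ ℤ.+-assoc (f (suc n)) (- x) x ⟩
  f (suc n) + (- x + x)   ≡⟨ cong (λ y → f (suc n) + y) (ℤ.+-inverseˡ x) ⟩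
  f (suc n) + 0ℤ          ≡⟨ ℤ.+-identityʳ _ ⟩
  f (suc n)               ∎
  where
  open ≡-Reasoning
  x = f 0 * g (suc n)
  f″ : Series
  f″ m = f (suc m) - f 0 * g (suc m)

-- poch a k N = (a; q^k)_N = ∏_{m<N} (1 - a q^{km})

poch : Series → ℕ → ℕ → Series
poch a k zero    = 1ₛ
poch a k (suc N) = poch a k N *ₛ (1ₛ -ₛ a *ₛ q^ (k ℕ.* N))

-- poch∞ a k = (a; q^k)_∞ for k ≥ 1.  The factors with m > n do not affect the
-- coefficient of q^n, so it can be read off (a; q^k)_{n+1}; see poch-stable.

poch∞ : Series → ℕ → Series
poch∞ a k n = poch a k (suc n) n

*ₛ-congʳ-≤ : ∀ f g h n → (∀ j → j ≤ n → g j ≡ h j) → (f *ₛ g) n ≡ (f *ₛ h) n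
*ₛ-congʳ-≤ f g h n eq = Sum.sum-cong-≗ {suc n} λ j →
  cong (f (toℕ j) *_) (eq (n ∸ toℕ j) (ℕ.m∸n≤m n (toℕ j)))

*ₛ-identityʳ : ∀ f → f *ₛ 1ₛ ≗ f
*ₛ-identityʳ f zero    = trans (ℤ.+-identityʳ _) (ℤ.*-identityʳ _)
*ₛ-identityʳ f (suc n) = trans
  (cong₂ _+_ (ℤ.*-zeroʳ (f 0)) (*ₛ-identityʳ (λ m → f (suc m)) n))
  (ℤ.+-identityˡ _)

q^-below : ∀ {e n} → n < e → (q^ e) n ≡ 0ℤ
q^-below {e} {n} n<e =
  cong (λ b → if b then 1ℤ else 0ℤ) (dec-false (n ℕ.≟ e) (ℕ.<⇒≢ n<e))

*ₛ-q^-below : ∀ f {e n} → n < e → (f *ₛ q^ e) n ≡ 0ℤ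
*ₛ-q^-below f {e} {n} n<e = begin
  (f *ₛ q^ e) n        ≡⟨ *ₛ-congʳ-≤ f (q^ e) (λ _ → 0ℤ) n (λ j j≤n → q^-below (ℕ.≤-<-trans j≤n n<e)) ⟩
  (f *ₛ (λ _ → 0ℤ)) n  ≡⟨ Sum.sum-cong-≗ {suc n} (λ j → ℤ.*-zeroʳ (f (toℕ j))) ⟩
  ∑[ j ≤ n ] 0ℤ        ≡⟨ Sum.sum-replicate-zero (suc n) ⟩
  0ℤ                   ∎
  where open ≡-Reasoning

poch-step : ∀ a k .{{_ : NonZero k}} N n → n < N → poch a k (suc N) n ≡ poch a k N n
poch-step a k N n n<N = trans
  (*ₛ-congʳ-≤ (poch a k N) (1ₛ -ₛ a *ₛ q^ (k ℕ.* N)) 1ₛ n λ j j≤n → trans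
    (cong (λ x → 1ₛ j - x)
      (*ₛ-q^-below a (ℕ.<-≤-trans (ℕ.≤-<-trans j≤n n<N) (ℕ.m≤n*m N k))))
    (ℤ.+-identityʳ _))
  (*ₛ-identityʳ (poch a k N) n)

poch-stable : ∀ a k .{{_ : NonZero k}} N n → n < N → poch a k N n ≡ poch∞ a k n
poch-stable a k N n n<N = go (ℕ.≤⇒≤′ n<N)
  where
  go : ∀ {N} → suc n ≤′ N → poch a k N n ≡ poch∞ a k n
  go ≤′-refl      = refl
  go (≤′-step lt) = trans (poch-step a k _ n (ℕ.≤′⇒≤ lt)) (go lt)

-- ∑ S_{k,i}(n) q^n = (-q)_∞ (q^i, q^{k-i}, q^k; q^k)_∞ / (q)_∞

S : ℕ → ℕ → Series
S k i =
  (poch∞ (-ₛ q^ 1) 1 *ₛ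
    (poch∞ (q^ i) k *ₛ poch∞ (q^ (k ∸ i)) k *ₛ poch∞ (q^ k) k))
  /ₛ poch∞ (q^ 1) 1

S-genFun : ∀ k i → S k i *ₛ poch∞ (q^ 1) 1
  ≗ poch∞ (-ₛ q^ 1) 1 *ₛ (poch∞ (q^ i) k *ₛ poch∞ (q^ (k ∸ i)) k *ₛ poch∞ (q^ k) k)
S-genFun k i = /ₛ-*ₛ-cancel
  (poch∞ (-ₛ q^ 1) 1 *ₛ (poch∞ (q^ i) k *ₛ poch∞ (q^ (k ∸ i)) k *ₛ poch∞ (q^ k) k))
  (poch∞ (q^ 1) 1) refl

{-# OPTIONS --safe #-}

-- As (1 + q^m) / (1 - q^m) = 1 + 2 ∑_{b≥1} q^{mb}, the quotient (-q)_∞ / (q)_∞ is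
-- 1 + 2 ∑_{a,b≥1} q^{ab} modulo 4, that is 1 + 2 ∑_{a≥1} q^{a²}, since the terms with
-- a ≠ b come in equal pairs.  By Jacobi's triple product, (q^i, q^{k-i}, q^k; q^k)_∞ is
-- a signed sum of the powers q^{k m(m-1)/2 + i m}, whose exponents are 0 modulo 3 or
-- k - i modulo 9.  Adding a square (possibly 0) to such an exponent gives a number
-- that is 2 modulo 3 only if this number is k - i modulo 9.

module Submission where

open import Defs
open import Algebra.Bundles using (CommutativeRing)
import Algebra.Properties.Ring as RingProperties
open import Data.Bool.Base using (if_then_else_)
import Data.Integer.Base as ℤ hiding (+_)
open ℤ using (ℤ; 0ℤ; 1ℤ)
open import Data.Integer.Divisibility.Signed as Signed
  using (_∣?_; divides; 0∣⇒≡0; ∣m∣n⇒∣m+n; ∣m⇒∣-m; ∣m⇒∣m*n; ∣n⇒∣m*n; ∣⇒∣ᵤ)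
import Data.Integer.Properties as ℤ
import Data.Integer.Tactic.RingSolver as ℤ-Solver
open import Data.Nat.Base as ℕ using (ℕ; NonZero; zero; suc)
open import Data.Nat.DivMod using ([m+kn]%n≡m%n; m∣n⇒o%n%m≡o%m; m%n<n; m≡m%n+[m/n]*n)
import Data.Nat.Divisibility as ℕ
import Data.Nat.Properties as ℕ
open import Data.Product.Base using (∃; ∃₂; _×_; _,_)
open import Data.Sum.Base using (_⊎_; inj₁; inj₂; map₁)
open import Function.Base using (_∘_; case_of_; flip)
open import Level using (0ℓ)
open import Relation.Binary.PropositionalEquality as ≡ using (_≡_; _≗_)
open import Relation.Nullary.Decidable
  using (yes; no; dec-false; decidable-stable; from-yes; _→-dec_; _⊎-dec_)
open import Relation.Nullary.Negation using (¬_; contradiction)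

-- Each claim concerns one coefficient, so nothing infinite is needed: for the coefficient of q^n
-- all series are compared modulo q^(n+1), where the products and the geometric series become
-- finite. Jacobi's identity is therefore proved in a finite form, for (z′; Q)_N (z; Q)_M with z z′
-- = Q, by induction on the number of factors. Treating z′ as an element of its own avoids inverting
-- z, and the q-binomial weights turn into 1 below the truncation order.
--
-- Divisibility is read off from the exponents that can occur, so the theta terms are followed only
-- through `Supported`. The modulus there is 4 for the triple product, but 2 for its product with
-- the squares, which enters the formula doubled.
--
-- Congruences modulo 2 and 4 are equations with explicit witnesses (`w`, `y`, `t`), which keeps the
-- argument within ring identities.

-- Finite sums in a commutative ring

module AntidiagonalSum {c ℓ} (R : CommutativeRing c ℓ) where
  open CommutativeRing R
  open import Algebra.Solver.Ring.NaturalCoefficients.Default commutativeSemiring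
  open import Relation.Binary.Reasoning.Setoid setoid

  -- Δ F n = ∑_{r+s=n} F r s
  Δ : (ℕ → ℕ → Carrier) → ℕ → Carrier
  Δ F zero    = F 0 0
  Δ F (suc n) = F 0 (suc n) + Δ (λ r → F (suc r)) n

  Δ-cong : ∀ {F G} n → (∀ r s → r ℕ.+ s ≡ n → F r s ≈ G r s) → Δ F n ≈ Δ G n
  Δ-cong zero    F≈G = F≈G 0 0 ≡.refl
  Δ-cong (suc n) F≈G = +-cong (F≈G 0 (suc n) ≡.refl)
    (Δ-cong n λ r s eq → F≈G (suc r) s (≡.cong suc eq))

  Δ-last : ∀ F n → Δ F (suc n) ≈ Δ (λ r s → F r (suc s)) n + F (suc n) 0
  Δ-last F zero    = refl
  Δ-last F (suc n) = begin
    F 0 (2 ℕ.+ n) + Δ (λ r → F (suc r)) (suc n)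
      ≈⟨ +-congˡ (Δ-last (λ r → F (suc r)) n) ⟩
    F 0 (2 ℕ.+ n) + (Δ (λ r s → F (suc r) (suc s)) n + F (2 ℕ.+ n) 0)
      ≈⟨ +-assoc _ _ _ ⟨
    F 0 (2 ℕ.+ n) + Δ (λ r s → F (suc r) (suc s)) n + F (2 ℕ.+ n) 0 ∎

  Δ-flip : ∀ F n → Δ F n ≈ Δ (flip F) n
  Δ-flip F zero    = refl
  Δ-flip F (suc n) = begin
    F 0 (suc n) + Δ (λ r → F (suc r)) n         ≈⟨ +-congˡ (Δ-flip (λ r → F (suc r)) n) ⟩
    F 0 (suc n) + Δ (λ r s → F (suc s) r) n     ≈⟨ +-comm _ _ ⟩
    Δ (λ r s → F (suc s) r) n + F 0 (suc n)     ≈⟨ Δ-last (flip F) n ⟨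
    Δ (flip F) (suc n)                          ∎

  Δ-distrib-+ : ∀ F G n → Δ (λ r s → F r s + G r s) n ≈ Δ F n + Δ G n
  Δ-distrib-+ F G zero    = refl
  Δ-distrib-+ F G (suc n) = trans
    (+-congˡ (Δ-distrib-+ (λ r → F (suc r)) (λ r → G (suc r)) n))
    (solve 4 (λ a b x y → (a :+ b) :+ (x :+ y) := (a :+ x) :+ (b :+ y)) refl _ _ _ _)

  *-distribˡ-Δ : ∀ x F n → x * Δ F n ≈ Δ (λ r s → x * F r s) n
  *-distribˡ-Δ x F zero    = refl
  *-distribˡ-Δ x F (suc n) = trans (distribˡ _ _ _) (+-congˡ (*-distribˡ-Δ x _ n))

module SymmetricSum {c ℓ} (R : CommutativeRing c ℓ) where
  open CommutativeRing R
  open import Algebra.Solver.Ring.NaturalCoefficients.Default commutativeSemiring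
  open import Relation.Binary.Reasoning.Setoid setoid

  ∑ : ℕ → (ℕ → Carrier) → Carrier
  ∑ zero    f = 0#
  ∑ (suc n) f = ∑ n f + f n

  ∑-cong : ∀ n {f g} → (∀ i → f i ≈ g i) → ∑ n f ≈ ∑ n g
  ∑-cong zero    f≈g = refl
  ∑-cong (suc n) f≈g = +-cong (∑-cong n f≈g) (f≈g n)

  ∑-distrib-+ : ∀ n f g → ∑ n (λ i → f i + g i) ≈ ∑ n f + ∑ n g
  ∑-distrib-+ zero    f g = sym (+-identityʳ 0#)
  ∑-distrib-+ (suc n) f g = trans (+-congʳ (∑-distrib-+ n f g))
    (solve 4 (λ a b x y → (a :+ b) :+ (x :+ y) := (a :+ x) :+ (b :+ y)) refl _ _ _ _)

  -- Enlarging the square adds a row, a column and a corner. By symmetry row and column have equal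
  -- sums, so one of them joins the witness `y`.
  ∑∑-symmetric : ∀ (F : ℕ → ℕ → Carrier) → (∀ i j → F i j ≈ F j i) →
    ∀ n → ∃ λ y → ∑ n (λ i → ∑ n (F i)) ≈ ∑ n (λ i → F i i) + (y + y)
  ∑∑-symmetric F F-sym zero    = 0# , sym (trans (+-identityˡ _) (+-identityˡ _))
  ∑∑-symmetric F F-sym (suc n) with y , eq ← ∑∑-symmetric F F-sym n = y + ∑ n (F n) , (begin
    ∑ n (λ i → ∑ n (F i) + F i n) + (∑ n (F n) + F n n)
      ≈⟨ +-congʳ (∑-distrib-+ n _ _) ⟩
    (∑ n (λ i → ∑ n (F i)) + ∑ n (λ i → F i n)) + (∑ n (F n) + F n n)
      ≈⟨ +-congʳ (+-cong eq (∑-cong n λ i → F-sym i n)) ⟩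
    ((∑ n (λ i → F i i) + (y + y)) + ∑ n (F n)) + (∑ n (F n) + F n n)
      ≈⟨ solve 4 (λ d y r l → ((d :+ (y :+ y)) :+ r) :+ (r :+ l)
           := (d :+ l) :+ ((y :+ r) :+ (y :+ r))) refl _ _ _ _ ⟩
    (∑ n (λ i → F i i) + F n n) + ((y + ∑ n (F n)) + (y + ∑ n (F n))) ∎)

-- The quotient (-q)_∞ / (q)_∞ modulo 4

module Pochhammer {c ℓ} (R : CommutativeRing c ℓ) (Q^ : ℕ → CommutativeRing.Carrier R) where
  open CommutativeRing R hiding (zero)
  open SymmetricSum R using (∑)
  open RingProperties ring using (-‿distribˡ-*; -‿involutive)
  open import Algebra.Solver.Ring.NaturalCoefficients.Default commutativeSemiring
  open import Relation.Binary.Reasoning.Setoid setoid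

  pochhammer : Carrier → ℕ → Carrier
  pochhammer x zero    = 1#
  pochhammer x (suc n) = pochhammer x n * (1# - x * Q^ n)

  -- With u n = y Q^n / (1 - y Q^n), each factor (1 + y Q^n) / (1 - y Q^n) is 1 + 2 u n.
  pochhammer-ratio-mod4 : ∀ y (u : ℕ → Carrier) →
    (∀ n → (1# - y * Q^ n) * u n ≈ y * Q^ n) → ∀ n → ∃ λ w → let v = ∑ n u + (w + w) in
    pochhammer (- y) n ≈ pochhammer y n * (1# + (v + v))
  pochhammer-ratio-mod4 y u u-eq zero    = 0# ,
    solve 0 (let o = con 0 :+ (con 0 :+ con 0) in con 1 := con 1 :* (con 1 :+ (o :+ o))) refl
  pochhammer-ratio-mod4 y u u-eq (suc n) with w , eq ← pochhammer-ratio-mod4 y u u-eq n =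
    -- From (1 + 2v)(1 + 2u) = 1 + 2(v + u + 2vu): the cross term `v * u n` goes into the doubled
    -- part.
    let v = ∑ n u + (w + w) in w + v * u n , (begin
    pochhammer (- y) n * (1# - - y * Q^ n)
      ≈⟨ *-cong eq factor ⟩
    pochhammer y n * (1# + (v + v)) * ((1# - x) * (1# + (u n + u n)))
      ≈⟨ solve 5 (λ P s w x u →
           let v = s :+ (w :+ w)
               v′ = (s :+ u) :+ ((w :+ v :* u) :+ (w :+ v :* u)) in
           P :* (con 1 :+ (v :+ v)) :* (x :* (con 1 :+ (u :+ u)))
             := P :* x :* (con 1 :+ (v′ :+ v′))) refl _ _ _ _ _ ⟩
    pochhammer y n * (1# - x) *
      (1# + ((∑ n u + u n + ((w + v * u n) + (w + v * u n))) +
             (∑ n u + u n + ((w + v * u n) + (w + v * u n))))) ∎)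
    where
    x = y * Q^ n

    factor : 1# - - y * Q^ n ≈ (1# - x) * (1# + (u n + u n))
    factor = begin
      1# - - y * Q^ n                    ≈⟨ +-congˡ (-‿cong (-‿distribˡ-* _ _)) ⟨
      1# - - x                           ≈⟨ +-congˡ (-‿involutive x) ⟩
      1# + x                             ≈⟨ +-congʳ (+-identityʳ 1#) ⟨
      (1# + 0#) + x                      ≈⟨ +-congʳ (+-congˡ (-‿inverseˡ x)) ⟨
      (1# + (- x + x)) + x
        ≈⟨ solve 2 (λ x y → (con 1 :+ (y :+ x)) :+ x := (con 1 :+ y) :+ (x :+ x)) refl x (- x) ⟩
      (1# - x) + (x + x)                 ≈⟨ +-congˡ (+-cong (u-eq n) (u-eq n)) ⟨
      (1# - x) + ((1# - x) * u n + (1# - x) * u n)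
        ≈⟨ solve 2 (λ x u → x :+ (x :* u :+ x :* u) := x :* (con 1 :+ (u :+ u))) refl _ _ ⟩
      (1# - x) * (1# + (u n + u n))      ∎

module GeometricSum {c ℓ} (R : CommutativeRing c ℓ) where
  open CommutativeRing R hiding (zero)
  open SymmetricSum R using (∑)
  open import Algebra.Solver.Ring.NaturalCoefficients.Default commutativeSemiring
  open import Relation.Binary.Reasoning.Setoid setoid

  -- The sum telescopes. `X` is given by its recurrence, so that the monomials `q^ (suc m * suc b)`
  -- can be inserted directly.
  geometric-sum : ∀ x (X : ℕ → Carrier) → (∀ n → X (suc n) ≈ x * X n) →
    ∀ n → (1# - x) * ∑ n X + X n ≈ X 0
  geometric-sum x X X-suc zero    = trans (+-congʳ (zeroʳ _)) (+-identityˡ _)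
  geometric-sum x X X-suc (suc n) = begin
    (1# - x) * (∑ n X + X n) + X (suc n)    ≈⟨ +-congˡ (X-suc n) ⟩
    (1# - x) * (∑ n X + X n) + x * X n
      ≈⟨ solve 4 (λ x y s t → (con 1 :+ y) :* (s :+ t) :+ x :* t
           := ((con 1 :+ y) :* s :+ t) :+ (y :+ x) :* t) refl x (- x) _ _ ⟩
    ((1# - x) * ∑ n X + X n) + (- x + x) * X n
      ≈⟨ +-cong (geometric-sum x X X-suc n) (trans (*-congʳ (-‿inverseˡ x)) (zeroˡ _)) ⟩
    X 0 + 0#                                ≈⟨ +-identityʳ _ ⟩
    X 0                                     ∎

  -- Modulo q^(n+1) high powers of `x` vanish, so a finite sum already plays the role of x / (1 -
  -- x).
  geometric-series : ∀ x (X : ℕ → Carrier) → X 0 ≈ x → (∀ n → X (suc n) ≈ x * X n) →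
    ∀ {n} → X n ≈ 0# → (1# - x) * ∑ n X ≈ x
  geometric-series x X X-zero X-suc {n} Xn≈0 = begin
    (1# - x) * ∑ n X          ≈⟨ +-identityʳ _ ⟨
    (1# - x) * ∑ n X + 0#     ≈⟨ +-congˡ Xn≈0 ⟨
    (1# - x) * ∑ n X + X n    ≈⟨ geometric-sum x X X-suc n ⟩
    X 0                       ≈⟨ X-zero ⟩
    x                         ∎

module QuotientMod4 {c ℓ} (R : CommutativeRing c ℓ) where
  open CommutativeRing R
  open import Algebra.Solver.Ring.NaturalCoefficients.Default commutativeSemiring
  open import Relation.Binary.Reasoning.Setoid setoid

  -- Here e, m, u, s stand for (q)_∞, (-q)_∞, ∑ q^(ab), ∑ q^(a²). Cancelling e leaves f = g(1 + 2v)
  -- with v = s + 2(y + w).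
  quotient-mod4 : ∀ {e e⁻¹ m u w s y f g} → e * e⁻¹ ≈ 1# →
    m ≈ e * (1# + ((u + (w + w)) + (u + (w + w)))) → u ≈ s + (y + y) → f * e ≈ m * g →
    let t = g * (y + w) in f ≈ g + (g * s + g * s) + (t + t + (t + t))
  quotient-mod4 {e} {e⁻¹} {m} {u} {w} {s} {y} {f} {g} e*e⁻¹≈1 m-eq u-eq f*e≈m*g = begin
    f                                           ≈⟨ *-identityʳ f ⟨
    f * 1#                                      ≈⟨ *-congˡ e*e⁻¹≈1 ⟨
    f * (e * e⁻¹)                               ≈⟨ *-assoc f e e⁻¹ ⟨
    f * e * e⁻¹                                 ≈⟨ *-congʳ (trans f*e≈m*g (*-congʳ m-eq)) ⟩
    e * (1# + (v + v)) * g * e⁻¹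
      ≈⟨ solve 4 (λ e v g h → e :* v :* g :* h := (e :* h) :* (g :* v)) refl _ _ _ _ ⟩
    e * e⁻¹ * (g * (1# + (v + v)))              ≈⟨ *-congʳ e*e⁻¹≈1 ⟩
    1# * (g * (1# + (v + v)))                   ≈⟨ *-identityˡ _ ⟩
    g * (1# + (v + v))                          ≈⟨ *-congˡ (+-congˡ (+-cong (+-congʳ u-eq) (+-congʳ u-eq))) ⟩
    g * (1# + (s + (y + y) + (w + w) + (s + (y + y) + (w + w))))
      ≈⟨ solve 4 (λ g s y w → let v = s :+ (y :+ y) :+ (w :+ w); t = g :* (y :+ w) in
           g :* (con 1 :+ (v :+ v)) := g :+ (g :* s :+ g :* s) :+ (t :+ t :+ (t :+ t)))
           refl g s y w ⟩
    g + (g * s + g * s) + (t + t + (t + t))     ∎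
    where
    v = u + (w + w)
    t = g * (y + w)

-- A finite form of Jacobi's triple product

module FiniteTripleProduct {c ℓ} (R : CommutativeRing c ℓ) (Q^ : ℕ → CommutativeRing.Carrier R)
  (Q^-zero : CommutativeRing._≈_ R (Q^ 0) (CommutativeRing.1# R))
  (Q^-+ : ∀ m n → CommutativeRing._≈_ R (Q^ (m ℕ.+ n)) (CommutativeRing._*_ R (Q^ m) (Q^ n)))
  where
  open CommutativeRing R hiding (zero)
  open AntidiagonalSum R
  open Pochhammer R Q^
  open RingProperties ring using (-‿distribˡ-*; -‿distribʳ-*; -‿involutive)
  open import Algebra.Solver.Ring.NaturalCoefficients.Default commutativeSemiring
  open import Relation.Binary.Reasoning.Setoid setoid

  p : ℕ → Carrier
  p = pochhammer (Q^ 1)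

  1-Q^ : ℕ → Carrier
  1-Q^ n = 1# - Q^ n

  1-Q^-cong : ∀ {m n} → m ≡ n → 1-Q^ m ≈ 1-Q^ n
  1-Q^-cong eq = reflexive (≡.cong 1-Q^ eq)

  1-Q^0≈0 : 1-Q^ 0 ≈ 0#
  1-Q^0≈0 = trans (+-congʳ (sym Q^-zero)) (-‿inverseʳ _)

  1-Q^-+ : ∀ r s → 1-Q^ (r ℕ.+ s) ≈ 1-Q^ s + Q^ s * 1-Q^ r
  1-Q^-+ r s = begin
    1# - Q^ (r ℕ.+ s)                         ≈⟨ +-congˡ (-‿cong (Q^-+ r s)) ⟩
    1# - Q^ r * Q^ s                          ≈⟨ +-congˡ (-‿distribˡ-* _ _) ⟩
    1# + - Q^ r * Q^ s                        ≈⟨ +-congʳ (+-identityʳ _) ⟨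
    (1# + 0#) + - Q^ r * Q^ s                 ≈⟨ +-congʳ (+-congˡ (-‿inverseˡ (Q^ s))) ⟨
    (1# + (- Q^ s + Q^ s)) + - Q^ r * Q^ s
      ≈⟨ solve 3 (λ n s r → (con 1 :+ (n :+ s)) :+ r :* s
           := (con 1 :+ n) :+ s :* (con 1 :+ r)) refl (- Q^ s) (Q^ s) (- Q^ r) ⟩
    1-Q^ s + Q^ s * 1-Q^ r                    ∎

  p-suc : ∀ n → p (suc n) ≈ p n * 1-Q^ (suc n)
  p-suc n = *-congˡ (+-congˡ (-‿cong (sym (Q^-+ 1 n))))

  module _ (h : ℕ → Carrier) (p*h≈1 : ∀ n → p n * h n ≈ 1#) where

    h-zero : h 0 ≈ 1#
    h-zero = trans (sym (*-identityˡ _)) (p*h≈1 0)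

    h≈1-Q^*h : ∀ n → h n ≈ 1-Q^ (suc n) * h (suc n)
    h≈1-Q^*h n = begin
      h n                                         ≈⟨ *-identityˡ _ ⟨
      1# * h n                                    ≈⟨ *-congʳ (p*h≈1 (suc n)) ⟨
      p (suc n) * h (suc n) * h n                 ≈⟨ *-congʳ (*-congʳ (p-suc n)) ⟩
      p n * 1-Q^ (suc n) * h (suc n) * h n
        ≈⟨ solve 4 (λ p x y h → p :* x :* y :* h := p :* h :* (x :* y)) refl _ _ _ _ ⟩
      p n * h n * (1-Q^ (suc n) * h (suc n))      ≈⟨ *-congʳ (p*h≈1 n) ⟩
      1# * (1-Q^ (suc n) * h (suc n))             ≈⟨ *-identityˡ _ ⟩
      1-Q^ (suc n) * h (suc n)                    ∎

    p*h-suc : ∀ r t → p (r ℕ.+ suc t) * h r ≈ p (r ℕ.+ t) * h r * 1-Q^ (suc (r ℕ.+ t))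
    p*h-suc r t = begin
      p (r ℕ.+ suc t) * h r                        ≈⟨ *-congʳ (reflexive (≡.cong p (ℕ.+-suc r t))) ⟩
      p (suc (r ℕ.+ t)) * h r                      ≈⟨ *-congʳ (p-suc (r ℕ.+ t)) ⟩
      p (r ℕ.+ t) * 1-Q^ (suc (r ℕ.+ t)) * h r
        ≈⟨ solve 3 (λ x y z → x :* y :* z := x :* z :* y) refl _ _ _ ⟩
      p (r ℕ.+ t) * h r * 1-Q^ (suc (r ℕ.+ t))     ∎

    -- p n * (h r * h s) is the q-binomial coefficient [n choose r], as h = 1 / p.
    qBinomialSum : (ℕ → ℕ → Carrier) → ℕ → Carrier
    qBinomialSum a n = p n * Δ (λ r s → a r s * (h r * h s)) n

    -- q-Pascal in disguise, by 1 - Q^{r+s} = (1 - Q^s) + Q^s (1 - Q^r).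
    qBinomialSum-sucˡ : ∀ a n → qBinomialSum a (suc n) ≈
      qBinomialSum (λ r s → a r (suc s) + Q^ s * a (suc r) s) n
    qBinomialSum-sucˡ a n = begin
      p (suc n) * Δ F (suc n)
        ≈⟨ *-congʳ (p-suc n) ⟩
      p n * 1-Q^ (suc n) * Δ F (suc n)
        ≈⟨ *-assoc _ _ _ ⟩
      p n * (1-Q^ (suc n) * Δ F (suc n))
        ≈⟨ *-congˡ (*-distribˡ-Δ _ F (suc n)) ⟩
      p n * Δ (λ r s → 1-Q^ (suc n) * F r s) (suc n)
        ≈⟨ *-congˡ (Δ-cong (suc n) split) ⟩
      p n * Δ (λ r s → G r s + H r s) (suc n)
        ≈⟨ *-congˡ (Δ-distrib-+ G H (suc n)) ⟩
      p n * (Δ G (suc n) + Δ H (suc n))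
        -- The factor `1-Q^ 0` kills one end term of each sum, which leaves two sums over r + s = n.
        ≈⟨ *-congˡ (+-cong (trans (Δ-last G n) (trans (+-congˡ G-last) (+-identityʳ _)))
                           (trans (+-congʳ H-first) (+-identityˡ _))) ⟩
      p n * (Δ (λ r s → G r (suc s)) n + Δ (λ r → H (suc r)) n)
        ≈⟨ *-congˡ (Δ-distrib-+ _ _ n) ⟨
      p n * Δ (λ r s → G r (suc s) + H (suc r) s) n
        ≈⟨ *-congˡ (Δ-cong n λ r s _ → merge r s) ⟩
      qBinomialSum (λ r s → a r (suc s) + Q^ s * a (suc r) s) n ∎
      where
      F G H : ℕ → ℕ → Carrier
      F r s = a r s * (h r * h s)
      G r s = a r s * (h r * (1-Q^ s * h s))
      H r s = Q^ s * a r s * ((1-Q^ r * h r) * h s)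

      split : ∀ r s → r ℕ.+ s ≡ suc n → 1-Q^ (suc n) * F r s ≈ G r s + H r s
      split r s eq = begin
        1-Q^ (suc n) * F r s              ≈⟨ *-congʳ (1-Q^-cong (≡.sym eq)) ⟩
        1-Q^ (r ℕ.+ s) * F r s            ≈⟨ *-congʳ (1-Q^-+ r s) ⟩
        (1-Q^ s + Q^ s * 1-Q^ r) * F r s
          ≈⟨ solve 6 (λ x q y a h k → (x :+ q :* y) :* (a :* (h :* k))
               := a :* (h :* (x :* k)) :+ q :* a :* ((y :* h) :* k)) refl _ _ _ _ _ _ ⟩
        G r s + H r s                     ∎

      G-last : G (suc n) 0 ≈ 0#
      G-last = begin
        a (suc n) 0 * (h (suc n) * (1-Q^ 0 * h 0))  ≈⟨ *-congˡ (*-congˡ (*-congʳ 1-Q^0≈0)) ⟩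
        a (suc n) 0 * (h (suc n) * (0# * h 0))
          ≈⟨ solve 3 (λ a h k → a :* (h :* (con 0 :* k)) := con 0) refl _ _ _ ⟩
        0# ∎

      H-first : H 0 (suc n) ≈ 0#
      H-first = begin
        Q^ (suc n) * a 0 (suc n) * ((1-Q^ 0 * h 0) * h (suc n))
          ≈⟨ *-congˡ (*-congʳ (*-congʳ 1-Q^0≈0)) ⟩
        Q^ (suc n) * a 0 (suc n) * ((0# * h 0) * h (suc n))
          ≈⟨ solve 4 (λ q a h k → q :* a :* ((con 0 :* h) :* k) := con 0) refl _ _ _ _ ⟩
        0# ∎

      merge : ∀ r s → G r (suc s) + H (suc r) s ≈
        (a r (suc s) + Q^ s * a (suc r) s) * (h r * h s)
      merge r s = begin
        a r (suc s) * (h r * (1-Q^ (suc s) * h (suc s))) +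
          Q^ s * a (suc r) s * ((1-Q^ (suc r) * h (suc r)) * h s)
          ≈⟨ +-cong (*-congˡ (*-congˡ (h≈1-Q^*h s))) (*-congˡ (*-congʳ (h≈1-Q^*h r))) ⟨
        a r (suc s) * (h r * h s) + Q^ s * a (suc r) s * (h r * h s)
          ≈⟨ distribʳ _ _ _ ⟨
        (a r (suc s) + Q^ s * a (suc r) s) * (h r * h s) ∎

    qBinomialSum-flip : ∀ a n → qBinomialSum a n ≈ qBinomialSum (flip a) n
    qBinomialSum-flip a n = *-congˡ (trans (Δ-flip _ n) (Δ-cong n λ r s _ → *-congˡ (*-comm _ _)))

    -- The other Pascal rule, by reflection. It serves for adding a factor in `z′`,
    -- `qBinomialSum-sucˡ` for one in `z`.
    qBinomialSum-sucʳ : ∀ a n → qBinomialSum a (suc n) ≈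
      qBinomialSum (λ r s → a (suc r) s + Q^ r * a r (suc s)) n
    qBinomialSum-sucʳ a n = trans (qBinomialSum-flip a (suc n))
      (trans (qBinomialSum-sucˡ (flip a) n) (qBinomialSum-flip _ n))

    module _ (z z′ : Carrier) (z*z′≈Q : z * z′ ≈ Q^ 1) where

      -- thetaTerm N r = (-1)^m z^m Q^{m(m-1)/2} with m = r - N; for m < 0 this uses z′ = Q / z.
      thetaTerm : ℕ → ℕ → Carrier
      thetaTerm zero    zero    = 1#
      thetaTerm zero    (suc r) = thetaTerm 0 r * - (z * Q^ r)
      thetaTerm (suc N) zero    = thetaTerm N 0 * - (z′ * Q^ N)
      thetaTerm (suc N) (suc r) = thetaTerm N r

      -z*-z′≈Q : ∀ r → - (z * Q^ r) * - (z′ * Q^ 0) ≈ Q^ (suc r)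
      -z*-z′≈Q r = begin
        - (z * Q^ r) * - (z′ * Q^ 0)       ≈⟨ -‿distribˡ-* _ _ ⟨
        - (z * Q^ r * - (z′ * Q^ 0))       ≈⟨ -‿cong (-‿distribʳ-* _ _) ⟨
        - (- (z * Q^ r * (z′ * Q^ 0)))     ≈⟨ -‿involutive _ ⟩
        z * Q^ r * (z′ * Q^ 0)             ≈⟨ *-congˡ (*-congˡ Q^-zero) ⟩
        z * Q^ r * (z′ * 1#)
          ≈⟨ solve 3 (λ z x y → z :* x :* (y :* con 1) := z :* y :* x) refl _ _ _ ⟩
        z * z′ * Q^ r                      ≈⟨ *-congʳ z*z′≈Q ⟩
        Q^ 1 * Q^ r                        ≈⟨ Q^-+ 1 r ⟨
        Q^ (suc r)                         ∎

      -- Consecutive terms have ratio -z Q^r; the weight Q^s makes it depend on r + s only, so it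
      -- comes out of the sum over r + s = n.
      thetaTerm-sucʳ : ∀ r s →
        Q^ s * thetaTerm 0 (suc r) ≈ thetaTerm 0 r * - (z * Q^ (r ℕ.+ s))
      thetaTerm-sucʳ r s = begin
        Q^ s * (t * - (z * Q^ r))      ≈⟨ *-congˡ (*-congˡ (-‿distribˡ-* _ _)) ⟩
        Q^ s * (t * (- z * Q^ r))
          ≈⟨ solve 4 (λ s t z r → s :* (t :* (z :* r)) := t :* (z :* (r :* s))) refl _ _ _ _ ⟩
        t * (- z * (Q^ r * Q^ s))      ≈⟨ *-congˡ (*-congˡ (Q^-+ r s)) ⟨
        t * (- z * Q^ (r ℕ.+ s))       ≈⟨ *-congˡ (-‿distribˡ-* _ _) ⟨
        t * - (z * Q^ (r ℕ.+ s))       ∎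
        where t = thetaTerm 0 r

      -- With m = r - N, the ratio of term m - 1 to term m is -z′ Q^(-m), and Q^r turns this into
      -- -z′ Q^N, which is independent of r.
      thetaTerm-sucˡ : ∀ N r → Q^ r * thetaTerm (suc N) r ≈ thetaTerm N r * - (z′ * Q^ N)
      thetaTerm-sucˡ N zero = trans (*-congʳ Q^-zero) (*-identityˡ _)
      thetaTerm-sucˡ zero (suc r) = begin
        Q^ (suc r) * t                       ≈⟨ *-congʳ (-z*-z′≈Q r) ⟨
        - (z * Q^ r) * - (z′ * Q^ 0) * t
          ≈⟨ solve 3 (λ x y t → x :* y :* t := t :* x :* y) refl _ _ _ ⟩
        t * - (z * Q^ r) * - (z′ * Q^ 0)     ∎
        where t = thetaTerm 0 r
      thetaTerm-sucˡ (suc N) (suc r) = begin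
        Q^ (1 ℕ.+ r) * t                ≈⟨ *-congʳ (Q^-+ 1 r) ⟩
        Q^ 1 * Q^ r * t                 ≈⟨ *-assoc _ _ _ ⟩
        Q^ 1 * (Q^ r * t)               ≈⟨ *-congˡ (thetaTerm-sucˡ N r) ⟩
        Q^ 1 * (u * - (z′ * Q^ N))      ≈⟨ *-congˡ (*-congˡ (-‿distribˡ-* _ _)) ⟩
        Q^ 1 * (u * (- z′ * Q^ N))
          ≈⟨ solve 4 (λ a u z b → a :* (u :* (z :* b)) := u :* (z :* (a :* b))) refl _ _ _ _ ⟩
        u * (- z′ * (Q^ 1 * Q^ N))      ≈⟨ *-congˡ (*-congˡ (Q^-+ 1 N)) ⟨
        u * (- z′ * Q^ (suc N))         ≈⟨ *-congˡ (-‿distribˡ-* _ _) ⟨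
        u * - (z′ * Q^ (suc N))         ∎
        where
        t = thetaTerm (suc N) r
        u = thetaTerm N r

      qBinomialSum-factor : ∀ {a b} n x → (∀ r s → r ℕ.+ s ≡ n → b r s ≈ a r s + a r s * - x) →
        qBinomialSum b n ≈ qBinomialSum a n * (1# - x)
      qBinomialSum-factor {a} {b} n x eq = begin
        qBinomialSum b n
          ≈⟨ *-congˡ (Δ-cong n λ r s rs≡n → trans (*-congʳ (eq r s rs≡n))
               (solve 3 (λ a x h → (a :+ a :* x) :* h := (con 1 :+ x) :* (a :* h)) refl _ _ _)) ⟩
        p n * Δ (λ r s → (1# - x) * (a r s * (h r * h s))) n
          ≈⟨ *-congˡ (*-distribˡ-Δ _ _ n) ⟨
        p n * ((1# - x) * Δ (λ r s → a r s * (h r * h s)) n)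
          ≈⟨ solve 3 (λ p x d → p :* (x :* d) := p :* d :* x) refl _ _ _ ⟩
        qBinomialSum a n * (1# - x) ∎

      -- For N = 0 this is the q-binomial theorem. Each new factor 1 - x combines neighbouring theta
      -- terms exactly as a Pascal rule does.
      theta-product : ∀ N M →
        pochhammer z′ N * pochhammer z M ≈ qBinomialSum (λ r _ → thetaTerm N r) (N ℕ.+ M)
      theta-product zero zero =
        *-congˡ (sym (trans (*-identityˡ _) (trans (*-cong h-zero h-zero) (*-identityˡ _))))
      theta-product zero (suc M) = begin
        1# * (pochhammer z M * (1# - z * Q^ M))
          ≈⟨ *-assoc _ _ _ ⟨
        1# * pochhammer z M * (1# - z * Q^ M)
          ≈⟨ *-congʳ (theta-product zero M) ⟩
        qBinomialSum (λ r _ → thetaTerm 0 r) M * (1# - z * Q^ M)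
          ≈⟨ qBinomialSum-factor M (z * Q^ M) (λ { r s ≡.refl → +-congˡ (thetaTerm-sucʳ r s) }) ⟨
        qBinomialSum (λ r s → thetaTerm 0 r + Q^ s * thetaTerm 0 (suc r)) M
          ≈⟨ qBinomialSum-sucˡ (λ r _ → thetaTerm 0 r) M ⟨
        qBinomialSum (λ r _ → thetaTerm 0 r) (suc M) ∎
      theta-product (suc N) M = begin
        pochhammer z′ N * (1# - z′ * Q^ N) * pochhammer z M
          ≈⟨ solve 3 (λ x y w → x :* y :* w := x :* w :* y) refl _ _ _ ⟩
        pochhammer z′ N * pochhammer z M * (1# - z′ * Q^ N)
          ≈⟨ *-congʳ (theta-product N M) ⟩
        qBinomialSum (λ r _ → thetaTerm N r) (N ℕ.+ M) * (1# - z′ * Q^ N)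
          ≈⟨ qBinomialSum-factor (N ℕ.+ M) (z′ * Q^ N) (λ r _ _ → +-congˡ (thetaTerm-sucˡ N r)) ⟨
        qBinomialSum (λ r _ → thetaTerm N r + Q^ r * thetaTerm (suc N) r) (N ℕ.+ M)
          ≈⟨ qBinomialSum-sucʳ (λ r _ → thetaTerm (suc N) r) (N ℕ.+ M) ⟨
        qBinomialSum (λ r _ → thetaTerm (suc N) r) (suc N ℕ.+ M) ∎

      -- The third product `p n` allows the weight to be written as p n / p r times p n / p s, which
      -- are 1 up to terms of order Q^(r+1) and Q^(s+1).
      triple-product : ∀ N M → let n = N ℕ.+ M in
        pochhammer z′ N * pochhammer z M * p n ≈
        Δ (λ r s → thetaTerm N r * ((p n * h r) * (p n * h s))) n
      triple-product N M = begin
        pochhammer z′ N * pochhammer z M * p n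
          ≈⟨ *-congʳ (theta-product N M) ⟩
        p n * Δ (λ r s → thetaTerm N r * (h r * h s)) n * p n
          ≈⟨ solve 2 (λ p d → p :* d :* p := p :* p :* d) refl (p n) _ ⟩
        p n * p n * Δ (λ r s → thetaTerm N r * (h r * h s)) n
          ≈⟨ *-distribˡ-Δ (p n * p n) _ n ⟩
        Δ (λ r s → p n * p n * (thetaTerm N r * (h r * h s))) n
          ≈⟨ Δ-cong n (λ r s _ → solve 4 (λ p t h k → p :* p :* (t :* (h :* k))
               := t :* ((p :* h) :* (p :* k))) refl (p n) (thetaTerm N r) (h r) (h s)) ⟩
        Δ (λ r s → thetaTerm N r * ((p n * h r) * (p n * h s))) n ∎
        where n = N ℕ.+ M

-- The ring of power series and its truncations

module ℤΔ = AntidiagonalSum ℤ.+-*-commutativeRing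

infixl 6 _+ₛ_

0ₛ : Series
0ₛ _ = 0ℤ

_+ₛ_ : Series → Series → Series
(f +ₛ g) n = f n ℤ.+ g n

*ₛ≡Δ : ∀ f g n → (f *ₛ g) n ≡ ℤΔ.Δ (λ r s → f r ℤ.* g s) n
*ₛ≡Δ f g zero    = ℤ.+-identityʳ _
*ₛ≡Δ f g (suc n) = ≡.cong ((f 0 ℤ.* g (suc n)) ℤ.+_) (*ₛ≡Δ (f ∘ suc) g n)

*ₛ-comm : ∀ f g → f *ₛ g ≗ g *ₛ f
*ₛ-comm f g n = begin
  (f *ₛ g) n                    ≡⟨ *ₛ≡Δ f g n ⟩
  ℤΔ.Δ (λ r s → f r ℤ.* g s) n     ≡⟨ ℤΔ.Δ-flip _ n ⟩
  ℤΔ.Δ (λ r s → f s ℤ.* g r) n     ≡⟨ ℤΔ.Δ-cong n (λ r s _ → ℤ.*-comm (f s) (g r)) ⟩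
  ℤΔ.Δ (λ r s → g r ℤ.* f s) n     ≡⟨ *ₛ≡Δ g f n ⟨
  (g *ₛ f) n                    ∎
  where open ≡.≡-Reasoning

*ₛ-distribʳ-+ₛ : ∀ h f g → (f +ₛ g) *ₛ h ≗ f *ₛ h +ₛ g *ₛ h
*ₛ-distribʳ-+ₛ h f g n = begin
  ((f +ₛ g) *ₛ h) n
    ≡⟨ *ₛ≡Δ (f +ₛ g) h n ⟩
  ℤΔ.Δ (λ r s → (f r ℤ.+ g r) ℤ.* h s) n
    ≡⟨ ℤΔ.Δ-cong n (λ r s _ → ℤ.*-distribʳ-+ (h s) (f r) (g r)) ⟩
  ℤΔ.Δ (λ r s → f r ℤ.* h s ℤ.+ g r ℤ.* h s) n
    ≡⟨ ℤΔ.Δ-distrib-+ _ _ n ⟩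
  ℤΔ.Δ (λ r s → f r ℤ.* h s) n ℤ.+ ℤΔ.Δ (λ r s → g r ℤ.* h s) n
    ≡⟨ ≡.cong₂ ℤ._+_ (*ₛ≡Δ f h n) (*ₛ≡Δ g h n) ⟨
  (f *ₛ h +ₛ g *ₛ h) n ∎
  where open ≡.≡-Reasoning

scale-*ₛ : ∀ x f g → (λ n → x ℤ.* f n) *ₛ g ≗ λ n → x ℤ.* (f *ₛ g) n
scale-*ₛ x f g n = begin
  ((λ m → x ℤ.* f m) *ₛ g) n            ≡⟨ *ₛ≡Δ (λ m → x ℤ.* f m) g n ⟩
  ℤΔ.Δ (λ r s → x ℤ.* f r ℤ.* g s) n       ≡⟨ ℤΔ.Δ-cong n (λ r s _ → ℤ.*-assoc x (f r) (g s)) ⟩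
  ℤΔ.Δ (λ r s → x ℤ.* (f r ℤ.* g s)) n     ≡⟨ ℤΔ.*-distribˡ-Δ x _ n ⟨
  x ℤ.* ℤΔ.Δ (λ r s → f r ℤ.* g s) n       ≡⟨ ≡.cong (x ℤ.*_) (*ₛ≡Δ f g n) ⟨
  x ℤ.* (f *ₛ g) n                      ∎
  where open ≡.≡-Reasoning

*ₛ-congˡ-≤ : ∀ f g h n → (∀ j → j ℕ.≤ n → f j ≡ g j) → (f *ₛ h) n ≡ (g *ₛ h) n
*ₛ-congˡ-≤ f g h n eq =
  ≡.trans (*ₛ-comm f h n) (≡.trans (*ₛ-congʳ-≤ h f g n eq) (*ₛ-comm h g n))

-- Induction along f = f₀ + q f′: the tail of `f *ₛ g` is `f₀g′ +ₛ f′ *ₛ g` by definition, so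
-- distributivity and scaling replace any reindexing of double sums.
*ₛ-assoc : ∀ f g h → (f *ₛ g) *ₛ h ≗ f *ₛ (g *ₛ h)
*ₛ-assoc f g h zero = begin
  (f₀g₀ ℤ.+ 0ℤ) ℤ.* h 0 ℤ.+ 0ℤ          ≡⟨ ≡.cong (λ x → x ℤ.* h 0 ℤ.+ 0ℤ) (ℤ.+-identityʳ f₀g₀) ⟩
  f₀g₀ ℤ.* h 0 ℤ.+ 0ℤ                   ≡⟨ ≡.cong (ℤ._+ 0ℤ) (ℤ.*-assoc (f 0) (g 0) (h 0)) ⟩
  f 0 ℤ.* (g 0 ℤ.* h 0) ℤ.+ 0ℤ
    ≡⟨ ≡.cong (λ x → f 0 ℤ.* x ℤ.+ 0ℤ) (ℤ.+-identityʳ (g 0 ℤ.* h 0)) ⟨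
  f 0 ℤ.* (g 0 ℤ.* h 0 ℤ.+ 0ℤ) ℤ.+ 0ℤ   ∎
  where
  open ≡.≡-Reasoning
  f₀g₀ = f 0 ℤ.* g 0
*ₛ-assoc f g h (suc n) = begin
  (f₀g₀ ℤ.+ 0ℤ) ℤ.* h (suc n) ℤ.+ ((f₀g′ +ₛ f′ *ₛ g) *ₛ h) n
    ≡⟨ ≡.cong₂ (λ x y → x ℤ.* h (suc n) ℤ.+ y) (ℤ.+-identityʳ f₀g₀)
         (*ₛ-distribʳ-+ₛ h f₀g′ (f′ *ₛ g) n) ⟩
  f₀g₀ ℤ.* h (suc n) ℤ.+ ((f₀g′ *ₛ h) n ℤ.+ ((f′ *ₛ g) *ₛ h) n)
    ≡⟨ ≡.cong₂ ℤ._+_ (ℤ.*-assoc (f 0) (g 0) (h (suc n)))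
         (≡.cong₂ ℤ._+_ (scale-*ₛ (f 0) g′ h n) (*ₛ-assoc f′ g h n)) ⟩
  a ℤ.+ (b ℤ.+ (f′ *ₛ (g *ₛ h)) n)
    ≡⟨ ℤ.+-assoc a b _ ⟨
  a ℤ.+ b ℤ.+ (f′ *ₛ (g *ₛ h)) n
    ≡⟨ ≡.cong (ℤ._+ (f′ *ₛ (g *ₛ h)) n) (ℤ.*-distribˡ-+ (f 0) (g 0 ℤ.* h (suc n)) ((g′ *ₛ h) n)) ⟨
  f 0 ℤ.* (g 0 ℤ.* h (suc n) ℤ.+ (g′ *ₛ h) n) ℤ.+ (f′ *ₛ (g *ₛ h)) n ∎
  where
  open ≡.≡-Reasoning
  f′ g′ f₀g′ : Series
  f′ = f ∘ suc
  g′ = g ∘ suc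
  f₀g′ m = f 0 ℤ.* g′ m
  f₀g₀ = f 0 ℤ.* g 0
  a = f 0 ℤ.* (g 0 ℤ.* h (suc n))
  b = f 0 ℤ.* (g′ *ₛ h) n

q^-*ₛ-q^ : ∀ a b → q^ a *ₛ q^ b ≗ q^ (a ℕ.+ b)
q^-*ₛ-q^ zero    b n       = ≡.trans (*ₛ-comm 1ₛ (q^ b) n) (*ₛ-identityʳ (q^ b) n)
q^-*ₛ-q^ (suc a) b zero    = ≡.refl
q^-*ₛ-q^ (suc a) b (suc n) = ≡.trans (ℤ.+-identityˡ _) (q^-*ₛ-q^ a b n)

-- Working up to order n turns the infinite products into finite ones.
module Truncation (n : ℕ) where

  infix 4 _≈_

  -- Congruence modulo q^(n+1). As a record, it lets `f` and `g` be inferred from a proof.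
  record _≈_ (f g : Series) : Set where
    constructor mk≈
    field coeff : ∀ {j} → j ℕ.≤ n → f j ≡ g j
  open _≈_ public

  ≗⇒≈ : ∀ {f g} → f ≗ g → f ≈ g
  ≗⇒≈ eq = mk≈ λ {j} _ → eq j

  *ₛ-cong : ∀ {f g h k} → f ≈ g → h ≈ k → f *ₛ h ≈ g *ₛ k
  *ₛ-cong {f} {g} {h} {k} f≈g h≈k = mk≈ λ {j} j≤n → ≡.trans
    (*ₛ-congˡ-≤ f g h j (λ i i≤j → coeff f≈g (ℕ.≤-trans i≤j j≤n)))
    (*ₛ-congʳ-≤ g h k j (λ i i≤j → coeff h≈k (ℕ.≤-trans i≤j j≤n)))

  truncatedSeries : CommutativeRing 0ℓ 0ℓ
  truncatedSeries = record
    { Carrier = Series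
    ; _≈_ = _≈_
    ; _+_ = _+ₛ_
    ; _*_ = _*ₛ_
    ; -_  = -ₛ_
    ; 0#  = 0ₛ
    ; 1#  = 1ₛ
    ; isCommutativeRing = record
      { isRing = record
        { +-isAbelianGroup = record
          { isGroup = record
            { isMonoid = record
              { isSemigroup = record
                { isMagma = record
                  { isEquivalence = record
                    { refl  = mk≈ λ _ → ≡.refl
                    ; sym   = λ f≈g → mk≈ λ j≤n → ≡.sym (coeff f≈g j≤n)
                    ; trans = λ f≈g g≈h → mk≈ λ j≤n → ≡.trans (coeff f≈g j≤n) (coeff g≈h j≤n)
                    }
                  ; ∙-cong = λ f≈g h≈k → mk≈ λ j≤n → ≡.cong₂ ℤ._+_ (coeff f≈g j≤n) (coeff h≈k j≤n)
                  }
                ; assoc = λ f g h → ≗⇒≈ λ j → ℤ.+-assoc (f j) (g j) (h j)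
                }
              ; identity = (λ f → ≗⇒≈ λ j → ℤ.+-identityˡ (f j)) , (λ f → ≗⇒≈ λ j → ℤ.+-identityʳ (f j))
              }
            ; inverse = (λ f → ≗⇒≈ λ j → ℤ.+-inverseˡ (f j)) , (λ f → ≗⇒≈ λ j → ℤ.+-inverseʳ (f j))
            ; ⁻¹-cong = λ f≈g → mk≈ λ j≤n → ≡.cong ℤ.-_ (coeff f≈g j≤n)
            }
          ; comm = λ f g → ≗⇒≈ λ j → ℤ.+-comm (f j) (g j)
          }
        ; *-cong = *ₛ-cong
        ; *-assoc = λ f g h → ≗⇒≈ (*ₛ-assoc f g h)
        ; *-identity =
            (λ f → ≗⇒≈ λ j → ≡.trans (*ₛ-comm 1ₛ f j) (*ₛ-identityʳ f j)) ,
            (λ f → ≗⇒≈ (*ₛ-identityʳ f))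
        ; distrib =
            (λ h f g → ≗⇒≈ λ j → ≡.trans (*ₛ-comm h (f +ₛ g) j) (≡.trans (*ₛ-distribʳ-+ₛ h f g j)
              (≡.cong₂ ℤ._+_ (*ₛ-comm f h j) (*ₛ-comm g h j)))) ,
            (λ h f g → ≗⇒≈ (*ₛ-distribʳ-+ₛ h f g))
        }
      ; *-comm = λ f g → ≗⇒≈ (*ₛ-comm f g)
      }
    }

-- Theta exponents: lower bounds and residues

module ThetaExponents where
  open import Data.Nat.Base
  open import Data.Nat.DivMod
  open import Data.Nat.Divisibility using (divides)
  open import Data.Nat.Properties
  open import Data.Nat.Solver using (module +-*-Solver)
  open ≡ using (refl; sym; trans; cong; subst; subst₂; module ≡-Reasoning)

  -- This is a n + k n(n-1)/2, in a form that needs no halving and follows the recursion of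
  -- `thetaTerm`.
  progressionSum : ℕ → ℕ → ℕ → ℕ
  progressionSum a k zero    = 0
  progressionSum a k (suc n) = progressionSum a k n + (a + k * n)

  -- thetaExponent i k N r = k m (m - 1) / 2 + i m with m = r - N
  thetaExponent : ℕ → ℕ → ℕ → ℕ → ℕ
  thetaExponent i k zero    r       = progressionSum i k r
  thetaExponent i k (suc N) zero    = progressionSum (k ∸ i) k (suc N)
  thetaExponent i k (suc N) (suc r) = thetaExponent i k N r

  progressionSum-lower : ∀ a k n → k * n ≤ progressionSum a k n + k
  progressionSum-lower a k zero    = ≤-trans (≤-reflexive (*-zeroʳ k)) z≤n
  progressionSum-lower a k (suc n) = begin
    k * suc n                                ≡⟨ *-suc k n ⟩
    k + k * n                                ≡⟨ +-comm k _ ⟩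
    k * n + k                                ≤⟨ +-monoˡ-≤ k (m≤n+m (k * n) a) ⟩
    a + k * n + k                            ≤⟨ +-monoˡ-≤ k (m≤n+m _ (progressionSum a k n)) ⟩
    progressionSum a k n + (a + k * n) + k   ∎
    where open ≤-Reasoning

  -- Non-constant terms of p L / p r have order at least k(r + 1); times the theta monomial they
  -- reach k N. For r < N the reason is that the exponent is at least k(N - r - 1).
  thetaExponent-lowerʳ : ∀ i k N r → k * N ≤ thetaExponent i k N r + k * suc r
  thetaExponent-lowerʳ i k zero r = ≤-trans (≤-reflexive (*-zeroʳ k)) z≤n
  thetaExponent-lowerʳ i k (suc N) zero =
    subst (λ x → k * suc N ≤ progressionSum (k ∸ i) k (suc N) + x) (sym (*-identityʳ k))
      (progressionSum-lower (k ∸ i) k (suc N))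
  thetaExponent-lowerʳ i k (suc N) (suc r) = begin
    k * suc N                                  ≡⟨ *-suc k N ⟩
    k + k * N                                  ≤⟨ +-monoʳ-≤ k (thetaExponent-lowerʳ i k N r) ⟩
    k + (thetaExponent i k N r + k * suc r)    ≡⟨ solve 3 (λ k e r →
       k :+ (e :+ k :* (con 1 :+ r)) := e :+ k :* (con 2 :+ r)) refl k _ r ⟩
    thetaExponent i k N r + k * suc (suc r)    ∎
    where
    open ≤-Reasoning
    open +-*-Solver

  -- The mirror bound, for p L / p s: now m = M - s, and for m > 0 the exponent is at least k(m -
  -- 1).
  thetaExponent-lowerˡ : ∀ i k N {M} r s → r + s ≡ N + M → k * M ≤ thetaExponent i k N r + k * suc s
  thetaExponent-lowerˡ i k zero r s refl = begin
    k * (r + s)                                ≡⟨ *-distribˡ-+ k r s ⟩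
    k * r + k * s                              ≤⟨ +-monoˡ-≤ (k * s) (progressionSum-lower i k r) ⟩
    progressionSum i k r + k + k * s           ≡⟨ +-assoc (progressionSum i k r) k (k * s) ⟩
    progressionSum i k r + (k + k * s)         ≡⟨ cong (progressionSum i k r +_) (*-suc k s) ⟨
    progressionSum i k r + k * suc s           ∎
    where open ≤-Reasoning
  thetaExponent-lowerˡ i k (suc N) {M} zero _ refl = begin
    k * M                        ≤⟨ *-monoʳ-≤ k (≤-trans (m≤n+m M (suc N)) (n≤1+n _)) ⟩
    k * suc (suc N + M)          ≤⟨ m≤n+m _ (thetaExponent i k (suc N) 0) ⟩
    thetaExponent i k (suc N) 0 + k * suc (suc N + M) ∎
    where open ≤-Reasoning
  thetaExponent-lowerˡ i k (suc N) (suc r) s eq = thetaExponent-lowerˡ i k N r s (suc-injective eq)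

  ≡0mod3∨≡cmod9 : ℕ → ℕ → Set
  ≡0mod3∨≡cmod9 c n = n % 3 ≡ 0 ⊎ n % 9 ≡ c

  by-thirds : ∀ {P : ℕ → Set} → (∀ t → P (t * 3 + 0)) → (∀ t → P (t * 3 + 1)) → (∀ t → P (t * 3 + 2)) →
    ∀ n → P n
  by-thirds {P} p₀ p₁ p₂ n =
    subst P (sym (trans (m≡m%n+[m/n]*n n 3) (+-comm (n % 3) _))) (go (n % 3) (m%n<n n 3))
    where
    go : ∀ r → r < 3 → P (n / 3 * 3 + r)
    go 0 _ = p₀ (n / 3)
    go 1 _ = p₁ (n / 3)
    go 2 _ = p₂ (n / 3)
    go (suc (suc (suc _))) (s≤s (s≤s (s≤s ())))

  -- Three consecutive terms of an arithmetic progression add up to three times the middle one. This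
  -- gives period 3 modulo 3.
  progressionSum-3+ : ∀ a k n →
    progressionSum a k (3 + n) ≡ progressionSum a k n + (a + k * suc n) * 3
  progressionSum-3+ a k n = solve 4 (λ x a k n →
    x :+ (a :+ k :* n) :+ (a :+ k :* (con 1 :+ n)) :+ (a :+ k :* (con 2 :+ n))
      := x :+ (a :+ k :* (con 1 :+ n)) :* con 3) refl (progressionSum a k n) a k n
    where open +-*-Solver

  progressionSum-%3 : ∀ a k r t → progressionSum a k (t * 3 + r) % 3 ≡ progressionSum a k r % 3
  progressionSum-%3 a k r zero    = refl
  progressionSum-%3 a k r (suc t) = begin
    progressionSum a k (3 + n) % 3                        ≡⟨ cong (_% 3) (progressionSum-3+ a k n) ⟩
    (progressionSum a k n + (a + k * suc n) * 3) % 3      ≡⟨ [m+kn]%n≡m%n (progressionSum a k n) (a + k * suc n) 3 ⟩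
    progressionSum a k n % 3                              ≡⟨ progressionSum-%3 a k r t ⟩
    progressionSum a k r % 3                              ∎
    where
    open ≡-Reasoning
    n = t * 3 + r

  -- If 3 divides the middle term of the first block, it divides that of every later block, so each
  -- block adds a multiple of 9.
  progressionSum-%9 : ∀ a k r w → a + k * suc r ≡ w * 3 →
    ∀ t → progressionSum a k (t * 3 + r) % 9 ≡ progressionSum a k r % 9
  progressionSum-%9 a k r w eq zero    = refl
  progressionSum-%9 a k r w eq (suc t) = begin
    progressionSum a k (3 + n) % 9                        ≡⟨ cong (_% 9) (progressionSum-3+ a k n) ⟩
    (progressionSum a k n + (a + k * suc n) * 3) % 9      ≡⟨ cong (λ x → (progressionSum a k n + x) % 9) *9 ⟩
    (progressionSum a k n + (w + k * t) * 9) % 9          ≡⟨ [m+kn]%n≡m%n (progressionSum a k n) (w + k * t) 9 ⟩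
    progressionSum a k n % 9                              ≡⟨ progressionSum-%9 a k r w eq t ⟩
    progressionSum a k r % 9                              ∎
    where
    open ≡-Reasoning
    open +-*-Solver
    n = t * 3 + r
    *9 : (a + k * suc n) * 3 ≡ (w + k * t) * 9
    *9 = begin
      (a + k * suc n) * 3
        ≡⟨ solve 4 (λ a k t r → (a :+ k :* (con 1 :+ (t :* con 3 :+ r))) :* con 3
             := (a :+ k :* (con 1 :+ r)) :* con 3 :+ k :* t :* con 9) refl a k t r ⟩
      (a + k * suc r) * 3 + k * t * 9      ≡⟨ cong (λ x → x * 3 + k * t * 9) eq ⟩
      w * 3 * 3 + k * t * 9
        ≡⟨ solve 2 (λ w x → w :* con 3 :* con 3 :+ x :* con 9 := (w :+ x) :* con 9) refl w (k * t) ⟩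
      (w + k * t) * 9                      ∎

  module _ (i₀ j : ℕ) where
    open +-*-Solver
    private
      i k : ℕ
      i = i₀ * 3
      k = i + j

    -- Modulus 9 is needed for n ≡ 2 modulo 3 only, where the first value is 2i + k = 3i + j and 9
    -- divides 3i.
    progressionSum-i-residues : ∀ n → ≡0mod3∨≡cmod9 (j % 9) (progressionSum i k n)
    progressionSum-i-residues = by-thirds
      (λ t → inj₁ (progressionSum-%3 i k 0 t))
      (λ t → inj₁ (trans (progressionSum-%3 i k 1 t) (trans
        (cong (_% 3) (solve 2 (λ x k → x :+ k :* con 0 := x) refl i k)) (m*n%n≡0 i₀ 3))))
      (λ t → inj₂ (trans
        (progressionSum-%9 i k 2 (i₀ + k)
          (solve 2 (λ x k → x :* con 3 :+ k :* con 3 := (x :+ k) :* con 3) refl i₀ k) t)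
        (trans (cong (_% 9) (solve 2 (λ x j → let i = x :* con 3; k = i :+ j in
            i :+ k :* con 0 :+ (i :+ k :* con 1) := j :+ x :* con 9) refl i₀ j))
          ([m+kn]%n≡m%n j i₀ 9))))

    -- Here n ≡ 1 is the class with residue j: its blocks have middle terms congruent to j + 2k = 3j
    -- + 2i modulo 3. For n ≡ 2 the value starts at 3j + i.
    progressionSum-j-residues : ∀ n → ≡0mod3∨≡cmod9 (j % 9) (progressionSum j k n)
    progressionSum-j-residues = by-thirds
      (λ t → inj₁ (progressionSum-%3 j k 0 t))
      (λ t → inj₂ (trans
        (progressionSum-%9 j k 1 (j + 2 * i₀)
          (solve 2 (λ x j → let k = x :* con 3 :+ j in
            j :+ k :* con 2 := (j :+ con 2 :* x) :* con 3) refl i₀ j) t)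
        (cong (_% 9) (solve 2 (λ j k → j :+ k :* con 0 := j) refl j k))))
      (λ t → inj₁ (trans (progressionSum-%3 j k 2 t) (trans
        (cong (_% 3) (solve 2 (λ x j → let i = x :* con 3; k = i :+ j in
          j :+ k :* con 0 :+ (j :+ k :* con 1) := (j :+ x) :* con 3) refl i₀ j))
        (m*n%n≡0 (j + i₀) 3))))

  thetaExponent-residues : ∀ {i k} → i ≤ k → i % 3 ≡ 0 →
    ∀ N r → ≡0mod3∨≡cmod9 ((k ∸ i) % 9) (thetaExponent i k N r)
  thetaExponent-residues {i} {k} i≤k i%3≡0 = go
    where
    i₀ = i / 3
    i≡i₀*3 : i ≡ i₀ * 3
    i≡i₀*3 = trans (m≡m%n+[m/n]*n i 3) (cong (_+ i₀ * 3) i%3≡0)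
    k≡ : k ≡ i₀ * 3 + (k ∸ i)
    k≡ = trans (sym (m+[n∸m]≡n i≤k)) (cong (_+ (k ∸ i)) i≡i₀*3)

    go : ∀ N r → ≡0mod3∨≡cmod9 ((k ∸ i) % 9) (thetaExponent i k N r)
    go zero    r       = subst₂ (λ a b → ≡0mod3∨≡cmod9 ((k ∸ i) % 9) (progressionSum a b r))
      (sym i≡i₀*3) (sym k≡) (progressionSum-i-residues i₀ (k ∸ i) r)
    go (suc N) zero    = subst (λ b → ≡0mod3∨≡cmod9 ((k ∸ i) % 9) (progressionSum (k ∸ i) b (suc N)))
      (sym k≡) (progressionSum-j-residues i₀ (k ∸ i) (suc N))
    go (suc N) (suc r) = go N r

  -- Squares are 0 or 1 modulo 3, so e ≡ 0 cannot give 2 modulo 3. If e ≡ c modulo 9, then 3 divides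
  -- a², hence 9 does. `check` runs through all residues modulo 9.
  square+residues : ∀ {c} → c < 9 → c % 3 ≡ 2 → ∀ a {e n} → ≡0mod3∨≡cmod9 c e → a * a + e ≡ n →
    n % 3 ≡ 2 → n % 9 ≡ c
  square+residues {c} c<9 c%3≡2 a {e} {n} e-good a²+e≡n n%3≡2 = trans n%9≡
    (check c<9 (m%n<n a 9) (m%n<n e 9) c%3≡2 (map₁ (trans (%9%3 e)) e-good)
      (trans (cong (_% 3) (sym n%9≡)) (trans (%9%3 n) n%3≡2)))
    where
    open ≡-Reasoning
    %9%3 : ∀ m → m % 9 % 3 ≡ m % 3
    %9%3 m = m∣n⇒o%n%m≡o%m 3 9 m (divides 3 refl)

    n%9≡ : n % 9 ≡ (a % 9 * (a % 9) + e % 9) % 9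
    n%9≡ = begin
      n % 9                                            ≡⟨ cong (_% 9) a²+e≡n ⟨
      (a * a + e) % 9                                  ≡⟨ %-distribˡ-+ (a * a) e 9 ⟩
      ((a * a) % 9 + e % 9) % 9                        ≡⟨ cong (λ x → (x + e % 9) % 9) (%-distribˡ-* a a 9) ⟩
      ((a % 9 * (a % 9)) % 9 + e % 9) % 9              ≡⟨ cong (λ x → ((a % 9 * (a % 9)) % 9 + x) % 9) (m%n%n≡m%n e 9) ⟨
      ((a % 9 * (a % 9)) % 9 + e % 9 % 9) % 9          ≡⟨ %-distribˡ-+ (a % 9 * (a % 9)) (e % 9) 9 ⟨
      (a % 9 * (a % 9) + e % 9) % 9                    ∎

    check : ∀ {c} → c < 9 → ∀ {a} → a < 9 → ∀ {e} → e < 9 →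
      c % 3 ≡ 2 → e % 3 ≡ 0 ⊎ e ≡ c → (a * a + e) % 9 % 3 ≡ 2 → (a * a + e) % 9 ≡ c
    check = from-yes (allUpTo? (λ c → allUpTo? (λ a → allUpTo? (λ e →
      (c % 3 ≟ 2) →-dec ((e % 3 ≟ 0) ⊎-dec (e ≟ c)) →-dec
      ((a * a + e) % 9 % 3 ≟ 2) →-dec ((a * a + e) % 9 ≟ c)) 9) 9) 9)

open import Data.Nat using (_+_; _*_; _∸_; _≤_; _<_; _%_; _/_; s≤s)
open import Data.Integer using (+_)
open import Data.Integer.Divisibility using (_∣_)
open ThetaExponents
open ≡ using (refl; cong)

-- Supports of series modulo an integer

-- Divisibility is decidable, so a bad summand can be found by search.
Δ-nondivisible : ∀ d F n → ¬ d Signed.∣ ℤΔ.Δ F n →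
  ∃₂ λ r s → r + s ≡ n × ¬ d Signed.∣ F r s
Δ-nondivisible d F zero    d∤Δ = 0 , 0 , refl , d∤Δ
Δ-nondivisible d F (suc n) d∤Δ with d ∣? F 0 (suc n)
... | no  d∤F = 0 , suc n , refl , d∤F
... | yes d∣F with r , s , eq , d∤F ← Δ-nondivisible d (F ∘ suc) n (d∤Δ ∘ ∣m∣n⇒∣m+n d∣F) =
  suc r , s , cong suc eq , d∤F

-- Supports modulo d and up to order n; for d = 0 these are the usual supports.
module Support (n : ℕ) (d : ℤ) where
  open Truncation n

  record Supported (A : ℕ → Set) (f : Series) : Set where
    constructor mkSupported
    field support : ∀ {j} → j ≤ n → ¬ d Signed.∣ f j → A j
  open Supported public

  private variable
    A B : ℕ → Set
    f g : Series

  ≡0⇒d∣ : ∀ {x} → x ≡ 0ℤ → d Signed.∣ x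
  ≡0⇒d∣ refl = divides 0ℤ refl

  unsupported : Supported A f → ∀ {j} → j ≤ n → ¬ A j → d Signed.∣ f j
  unsupported f-supp j≤n j∉A = decidable-stable (d ∣? _) (j∉A ∘ support f-supp j≤n)

  supported-⊆ : (∀ {j} → j ≤ n → A j → B j) → Supported A f → Supported B f
  supported-⊆ A⊆B f-supp = mkSupported λ j≤n d∤f → A⊆B j≤n (support f-supp j≤n d∤f)

  supported-≈ : f ≈ g → Supported A f → Supported A g
  supported-≈ f≈g f-supp = mkSupported λ j≤n d∤g →
    support f-supp j≤n (d∤g ∘ ≡.subst (d Signed.∣_) (coeff f≈g j≤n))

  supported-q^ : ∀ e → Supported (_≡ e) (q^ e)
  supported-q^ e = mkSupported λ {j} _ d∤q^ → case j ℕ.≟ e of λ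
    { (yes j≡e) → j≡e
    ; (no  j≢e) → contradiction
        (≡0⇒d∣ (cong (λ b → if b then 1ℤ else 0ℤ) (dec-false (j ℕ.≟ e) j≢e))) d∤q^
    }

  supported-0 : Supported A 0ₛ
  supported-0 = mkSupported λ _ d∤0 → contradiction (≡0⇒d∣ refl) d∤0

  supported-neg : Supported A f → Supported A (-ₛ f)
  supported-neg f-supp = mkSupported λ j≤n d∤-f → support f-supp j≤n (d∤-f ∘ ∣m⇒∣-m)

  supported-+ : Supported A f → Supported A g → Supported A (f +ₛ g)
  supported-+ {f = f} f-supp g-supp = mkSupported λ {j} j≤n d∤f+g → case d ∣? f j of λ
    { (no  d∤f) → support f-supp j≤n d∤f
    ; (yes d∣f) → support g-supp j≤n (d∤f+g ∘ ∣m∣n⇒∣m+n d∣f)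
    }

  supported-* : Supported A f → Supported B g →
    Supported (λ j → ∃₂ λ r s → r + s ≡ j × A r × B s) (f *ₛ g)
  supported-* {A} {f} {B} {g} f-supp g-supp = mkSupported go
    where
    go : ∀ {j} → j ≤ n → ¬ d Signed.∣ (f *ₛ g) j → ∃₂ λ r s → r + s ≡ j × A r × B s
    go {j} j≤n d∤fg
      with r , s , refl , d∤ ← Δ-nondivisible d (λ r s → f r ℤ.* g s) j
             (d∤fg ∘ ≡.subst (d Signed.∣_) (≡.sym (*ₛ≡Δ f g j))) =
      r , s , refl ,
      support f-supp (ℕ.≤-trans (ℕ.m≤m+n r s) j≤n) (d∤ ∘ ∣m⇒∣m*n (g s)) ,
      support g-supp (ℕ.≤-trans (ℕ.m≤n+m s r) j≤n) (d∤ ∘ ∣n⇒∣m*n (f r))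

  open AntidiagonalSum truncatedSeries using (Δ)
  open SymmetricSum truncatedSeries using (∑)

  supported-Δ : ∀ F m → (∀ r s → r + s ≡ m → Supported A (F r s)) → Supported A (Δ F m)
  supported-Δ F zero    F-supp = F-supp 0 0 refl
  supported-Δ F (suc m) F-supp = supported-+ (F-supp 0 (suc m) refl)
    (supported-Δ (F ∘ suc) m λ r s eq → F-supp (suc r) s (cong suc eq))

  supported-∑ : ∀ {F} m → (∀ i → Supported A (F i)) → Supported A (∑ m F)
  supported-∑ zero    F-supp = supported-0
  supported-∑ (suc m) F-supp = supported-+ (supported-∑ m F-supp) (F-supp m)

-- A coefficient not divisible by d is nonzero. Thus one support computed over ℤ serves both modulo
-- 4 and modulo 2.
supported-0⇒ : ∀ {n} d {A f} → Support.Supported n 0ℤ A f → Support.Supported n d A f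
supported-0⇒ {n} d f-supp = Support.mkSupported λ j≤n d∤f →
  Support.support f-supp j≤n (d∤f ∘ Support.≡0⇒d∣ n d ∘ 0∣⇒≡0)

-- The exponents of the triple product

poch-constant : ∀ a k → a 0 ≡ 0ℤ → ∀ N → poch a k N 0 ≡ 1ℤ
poch-constant a k a₀≡0 zero    = refl
poch-constant a k a₀≡0 (suc N) rewrite a₀≡0 | poch-constant a k a₀≡0 N = refl

module TruncatedPochhammer (n k : ℕ) where
  open Truncation n
  open CommutativeRing truncatedSeries using () renaming (trans to ≈-trans)
  open Pochhammer truncatedSeries (λ m → q^ (k * m)) public

  poch≡pochhammer : ∀ a N → poch a k N ≡ pochhammer a N
  poch≡pochhammer a zero    = refl
  poch≡pochhammer a (suc N) = cong (_*ₛ (1ₛ -ₛ a *ₛ q^ (k * N))) (poch≡pochhammer a N)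

  poch∞≈pochhammer : ∀ .{{_ : NonZero k}} a N → n < N → poch∞ a k ≈ pochhammer a N
  poch∞≈pochhammer a N n<N = mk≈ λ {j} j≤n → ≡.trans
    (≡.sym (poch-stable a k N j (ℕ.≤-<-trans j≤n n<N)))
    (cong (λ f → f j) (poch≡pochhammer a N))

  pochhammer-inverse : ∀ a → a 0 ≡ 0ℤ → ∀ N → pochhammer a N *ₛ (1ₛ /ₛ pochhammer a N) ≈ 1ₛ
  pochhammer-inverse a a₀≡0 N = ≈-trans (≗⇒≈ (*ₛ-comm (pochhammer a N) _))
    (≗⇒≈ (/ₛ-*ₛ-cancel 1ₛ (pochhammer a N)
      (≡.trans (cong (λ f → f 0) (≡.sym (poch≡pochhammer a N))) (poch-constant a k a₀≡0 N))))

module TripleProductSupport (n k-1 i : ℕ) (i≤k : i ≤ suc k-1) where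
  -- The successor form provides `NonZero k` and lets `k * N` unfold to `N + k-1 * N`.
  k = suc k-1
  -- Large enough for k N > n, so that both lower bounds on exponents pass the truncation order.
  N = suc n
  L = N + N
  open Truncation n
  open CommutativeRing truncatedSeries using (setoid; *-cong; *-congˡ; *-congʳ)
    renaming (sym to ≈-sym; trans to ≈-trans; reflexive to ≈-reflexive)
  open import Relation.Binary.Reasoning.Setoid setoid
  open AntidiagonalSum truncatedSeries
  open TruncatedPochhammer n k
  open Support n 0ℤ

  Q^_ : ℕ → Series
  Q^ m = q^ (k * m)

  Q^-zero : Q^ 0 ≈ 1ₛ
  Q^-zero = ≈-reflexive (cong q^_ (ℕ.*-zeroʳ k))

  Q^-+ : ∀ l m → Q^ (l + m) ≈ Q^ l *ₛ Q^ m
  Q^-+ l m = ≈-trans (≈-reflexive (cong q^_ (ℕ.*-distribˡ-+ k l m)))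
    (≈-sym (≗⇒≈ (q^-*ₛ-q^ (k * l) (k * m))))

  open FiniteTripleProduct truncatedSeries Q^_ Q^-zero Q^-+

  h : ℕ → Series
  h m = 1ₛ /ₛ p m

  p*h≈1 : ∀ m → p m *ₛ h m ≈ 1ₛ
  p*h≈1 = pochhammer-inverse (Q^ 1) refl

  z*z′≈Q : q^ i *ₛ q^ (k ∸ i) ≈ Q^ 1
  z*z′≈Q = ≈-trans (≗⇒≈ (q^-*ₛ-q^ i (k ∸ i)))
    (≈-reflexive (cong q^_ (≡.trans (ℕ.m+[n∸m]≡n i≤k) (≡.sym (ℕ.*-identityʳ k)))))

  tripleProduct : Series
  tripleProduct = poch∞ (q^ i) k *ₛ poch∞ (q^ (k ∸ i)) k *ₛ poch∞ (q^ k) k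

  θ : ℕ → ℕ → Series
  θ = thetaTerm h p*h≈1 (q^ i) (q^ (k ∸ i)) z*z′≈Q

  tripleProduct≈Δ : tripleProduct ≈ Δ (λ r s → θ N r *ₛ ((p L *ₛ h r) *ₛ (p L *ₛ h s))) L
  tripleProduct≈Δ = begin
    poch∞ (q^ i) k *ₛ poch∞ (q^ (k ∸ i)) k *ₛ poch∞ (q^ k) k
      ≈⟨ *-cong (*-cong (poch∞≈pochhammer (q^ i) N ℕ.≤-refl)
           (poch∞≈pochhammer (q^ (k ∸ i)) N ℕ.≤-refl))
           -- Any cut beyond `n` is allowed; `L` factors match the `p L` of `triple-product`.
           (poch∞≈pochhammer (q^ k) L (ℕ.m≤m+n N N)) ⟩
    pochhammer (q^ i) N *ₛ pochhammer (q^ (k ∸ i)) N *ₛ pochhammer (q^ k) L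
      ≈⟨ *-cong (≗⇒≈ (*ₛ-comm (pochhammer (q^ i) N) (pochhammer (q^ (k ∸ i)) N)))
           (≈-reflexive (cong (λ e → pochhammer (q^ e) L) (≡.sym (ℕ.*-identityʳ k)))) ⟩
    pochhammer (q^ (k ∸ i)) N *ₛ pochhammer (q^ i) N *ₛ p L
      ≈⟨ triple-product h p*h≈1 (q^ i) (q^ (k ∸ i)) z*z′≈Q N N ⟩
    Δ (λ r s → θ N r *ₛ ((p L *ₛ h r) *ₛ (p L *ₛ h s))) L ∎

  supported-*q^ : ∀ {f e} a b → Supported (_≡ e) f → Supported (_≡ e + (a + b)) (f *ₛ -ₛ (q^ a *ₛ q^ b))
  supported-*q^ a b f-supp = supported-⊆ (λ { _ (r , s , refl , refl , refl) → refl })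
    (supported-* f-supp (supported-neg (supported-≈ (≈-sym (≗⇒≈ (q^-*ₛ-q^ a b))) (supported-q^ (a + b)))))

  supported-thetaTerm : ∀ M r → Supported (_≡ thetaExponent i k M r) (θ M r)
  supported-thetaTerm zero          zero    = supported-q^ 0
  supported-thetaTerm zero          (suc r) = supported-*q^ i (k * r) (supported-thetaTerm 0 r)
  -- Separate because `thetaExponent` passes from `progressionSum i` to `progressionSum (k ∸ i)`
  -- here; both start at 0.
  supported-thetaTerm (suc zero)    zero    = supported-*q^ (k ∸ i) (k * 0) (supported-thetaTerm 0 0)
  supported-thetaTerm (suc (suc M)) zero    =
    supported-*q^ (k ∸ i) (k * suc M) (supported-thetaTerm (suc M) 0)
  supported-thetaTerm (suc M)       (suc r) = supported-thetaTerm M r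

  ≡0∨≥ : ℕ → ℕ → Set
  ≡0∨≥ e j = j ≡ 0 ⊎ e ≤ j

  supported-1-Q^ : ∀ m → Supported (≡0∨≥ (k * m)) (1-Q^ m)
  supported-1-Q^ m = supported-+ (supported-⊆ (λ _ → inj₁) (supported-q^ 0))
    (supported-neg (supported-⊆ (λ { _ refl → inj₂ ℕ.≤-refl }) (supported-q^ (k * m))))

  -- p (r + t) / p r = (1 - Q^{r+1}) ⋯ (1 - Q^{r+t}); hence only the monomials θ N r are
  -- left in tripleProduct≈Δ up to order n.
  supported-p*h : ∀ r t → Supported (≡0∨≥ (k * suc r)) (p (r + t) *ₛ h r)
  supported-p*h r zero = supported-≈
    (≈-sym (≈-trans (*-congʳ (≈-reflexive (cong p (ℕ.+-identityʳ r)))) (p*h≈1 r)))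
    (supported-⊆ (λ _ → inj₁) (supported-q^ 0))
  supported-p*h r (suc t) = supported-≈ (≈-sym (p*h-suc h p*h≈1 r t))
    (supported-⊆
      (λ { _ (_ , _ , refl , inj₁ refl , inj₁ refl) → inj₁ refl
         ; _ (_ , _ , refl , inj₁ refl , inj₂ le)   →
             inj₂ (ℕ.≤-trans (ℕ.*-monoʳ-≤ k (s≤s (ℕ.m≤m+n r t))) le)
         ; _ (_ , y , refl , inj₂ le   , _)         → inj₂ (ℕ.≤-trans le (ℕ.m≤m+n _ y)) })
      (supported-* (supported-p*h r t) (supported-1-Q^ (suc (r + t)))))

  supported-tripleProduct : Supported (λ j → ∃₂ λ M r → j ≡ thetaExponent i k M r) tripleProduct
  supported-tripleProduct = supported-≈ (≈-sym tripleProduct≈Δ) (supported-Δ _ L term)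
    where
    n<k*N : n < k * N
    n<k*N = ℕ.m≤m+n N (k-1 * N)

    p*h-right : ∀ r s → r + s ≡ L → Supported (≡0∨≥ (k * suc s)) (p L *ₛ h s)
    p*h-right r s eq = ≡.subst (λ m → Supported (≡0∨≥ (k * suc s)) (p m *ₛ h s))
      (≡.trans (ℕ.+-comm s r) eq) (supported-p*h s r)

    p*h-left : ∀ r s → r + s ≡ L → Supported (≡0∨≥ (k * suc r)) (p L *ₛ h r)
    p*h-left r s eq = p*h-right s r (≡.trans (ℕ.+-comm s r) eq)

    term : ∀ r s → r + s ≡ L → Supported (λ j → ∃₂ λ M r → j ≡ thetaExponent i k M r)
      (θ N r *ₛ ((p L *ₛ h r) *ₛ (p L *ₛ h s)))
    term r s eq = supported-⊆
      (λ { _ (e , _ , refl , refl , _ , _ , refl , inj₁ refl , inj₁ refl) →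
             N , r , ℕ.+-identityʳ e
         -- A non-constant term of either quotient pushes the degree to k N > n.
         ; j≤n (e , _ , refl , refl , x , y , refl , inj₂ le , _) → contradiction
             (ℕ.≤-trans (thetaExponent-lowerʳ i k N r) (ℕ.+-monoʳ-≤ e (ℕ.≤-trans le (ℕ.m≤m+n x y))))
             (ℕ.<⇒≱ (ℕ.≤-<-trans j≤n n<k*N))
         ; j≤n (e , _ , refl , refl , x , y , refl , inj₁ _ , inj₂ le) → contradiction
             (ℕ.≤-trans (thetaExponent-lowerˡ i k N r s eq) (ℕ.+-monoʳ-≤ e (ℕ.≤-trans le (ℕ.m≤n+m y x))))
             (ℕ.<⇒≱ (ℕ.≤-<-trans j≤n n<k*N)) })
      (supported-* (supported-thetaTerm N r) (supported-* (p*h-left r s eq) (p*h-right r s eq)))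

-- The generating function modulo 4

module OverpartitionsMod4 (n : ℕ) where
  N = suc n
  open Truncation n
  open CommutativeRing truncatedSeries using (*-congˡ; *-congʳ)
    renaming (sym to ≈-sym; trans to ≈-trans; reflexive to ≈-reflexive)
  open SymmetricSum truncatedSeries
  open GeometricSum truncatedSeries
  open QuotientMod4 truncatedSeries
  open TruncatedPochhammer n 1

  squares : Series
  squares = ∑ N λ a → q^ (suc a * suc a)

  -- ∑_{b≥1} q^{(m+1)b}, up to the truncation order
  multiples : ℕ → Series
  multiples m = ∑ N λ b → q^ (suc m * suc b)

  q^-suc : ∀ m → q^ 1 *ₛ q^ (1 * m) ≈ q^ (suc m)
  q^-suc m = ≈-trans (≗⇒≈ (q^-*ₛ-q^ 1 (1 * m)))
    (≈-reflexive (cong (λ e → q^ (suc e)) (ℕ.*-identityˡ m)))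

  q^-vanishes : ∀ {e} → n < e → q^ e ≈ 0ₛ
  q^-vanishes n<e = mk≈ λ j≤n → q^-below (ℕ.≤-<-trans j≤n n<e)

  multiples-geometric : ∀ m → (1ₛ -ₛ q^ 1 *ₛ q^ (1 * m)) *ₛ multiples m ≈ q^ 1 *ₛ q^ (1 * m)
  multiples-geometric m = geometric-series (q^ 1 *ₛ q^ (1 * m)) (λ b → q^ (suc m * suc b))
    (≈-trans (≈-reflexive (cong q^_ (ℕ.*-identityʳ (suc m)))) (≈-sym (q^-suc m)))
    -- The remainder term has exponent (m + 1)(n + 2) > n.
    X-suc {N} (q^-vanishes (ℕ.≤-trans (ℕ.n≤1+n N) (ℕ.m≤m+n (suc N) (m * suc N))))
    where
    X-suc : ∀ b → q^ (suc m * suc (suc b)) ≈ q^ 1 *ₛ q^ (1 * m) *ₛ q^ (suc m * suc b)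
    X-suc b = ≈-trans (≈-reflexive (cong q^_ (ℕ.*-suc (suc m) (suc b))))
      (≈-trans (≈-sym (≗⇒≈ (q^-*ₛ-q^ (suc m) (suc m * suc b))))
        (*-congʳ {q^ (suc m * suc b)} (≈-sym (q^-suc m))))

  -- Applied to `S-genFun`: modulo 4, `S k i` is the triple product times 1 + 2 ∑ q^(a²).
  overpartitionQuotient : ∀ f g → f *ₛ poch∞ (q^ 1) 1 ≗ poch∞ (-ₛ q^ 1) 1 *ₛ g →
    ∃ λ t → f ≈ g +ₛ (g *ₛ squares +ₛ g *ₛ squares) +ₛ (t +ₛ t +ₛ (t +ₛ t))
  overpartitionQuotient f g fE≗Mg =
    let
      E = pochhammer (q^ 1) N
      w , ratio = pochhammer-ratio-mod4 (q^ 1) multiples multiples-geometric N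
      y , symm = ∑∑-symmetric (λ a b → q^ (suc a * suc b))
        (λ a b → ≈-reflexive (cong q^_ (ℕ.*-comm (suc a) (suc b)))) N
    in
    g *ₛ (y +ₛ w) ,
    quotient-mod4 {E} {1ₛ /ₛ E} {poch∞ (-ₛ q^ 1) 1} {∑ N multiples} {w} {squares} {y} {f} {g}
      (pochhammer-inverse (q^ 1) refl N)
      (≈-trans (poch∞≈pochhammer (-ₛ q^ 1) N ℕ.≤-refl) ratio)
      symm
      (≈-trans (*-congˡ {f} (≈-sym (poch∞≈pochhammer (q^ 1) N ℕ.≤-refl))) (≗⇒≈ fE≗Mg))

-- Divisibility by 4

4∣x+x+[x+x] : ∀ x → + 4 Signed.∣ x ℤ.+ x ℤ.+ (x ℤ.+ x)
4∣x+x+[x+x] x = divides x (x+x+[x+x]≡x*4 x)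
  where
  x+x+[x+x]≡x*4 : ∀ x → x ℤ.+ x ℤ.+ (x ℤ.+ x) ≡ x ℤ.* + 4
  x+x+[x+x]≡x*4 = ℤ-Solver.solve-∀

2∣x⇒4∣x+x : ∀ {x} → + 2 Signed.∣ x → + 4 Signed.∣ x ℤ.+ x
2∣x⇒4∣x+x (divides y refl) = divides y (y*2+y*2≡y*4 y)
  where
  y*2+y*2≡y*4 : ∀ y → y ℤ.* + 2 ℤ.+ y ℤ.* + 2 ≡ y ℤ.* + 4
  y*2+y*2≡y*4 = ℤ-Solver.solve-∀

∸%3≡2 : ∀ {k i} → i ≤ k → k % 3 ≡ 2 → i % 3 ≡ 0 → (k ∸ i) % 3 ≡ 2
∸%3≡2 {k} {i} i≤k k%3≡2 i%3≡0 = begin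
  (k ∸ i) % 3                          ≡⟨ [m+kn]%n≡m%n (k ∸ i) (i / 3) 3 ⟨
  (k ∸ i + i / 3 * 3) % 3              ≡⟨ cong (λ x → (k ∸ i + (x + i / 3 * 3)) % 3) i%3≡0 ⟨
  (k ∸ i + (i % 3 + i / 3 * 3)) % 3    ≡⟨ cong (λ x → (k ∸ i + x) % 3) (m≡m%n+[m/n]*n i 3) ⟨
  (k ∸ i + i) % 3                      ≡⟨ cong (_% 3) (ℕ.m∸n+n≡m i≤k) ⟩
  k % 3                                ≡⟨ k%3≡2 ⟩
  2                                    ∎
  where open ≡.≡-Reasoning

-- As n is neither an exponent of `P` nor a square plus one, 4 divides the coefficient of `P` and 2
-- that of `P *ₛ squares`, which is doubled.
4∣S : ∀ k i → i ≤ k → k % 3 ≡ 2 → i % 3 ≡ 0 →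
  ∀ n → n % 3 ≡ 2 → ¬ n % 9 ≡ (k ∸ i) % 9 → + 4 ∣ S k i n
-- `k % 3 ≡ 2` rules out k = 0.
4∣S k@(suc k-1) i i≤k k%3≡2 i%3≡0 n n%3≡2 n%9≢c =
  let t , S≈ = OverpartitionsMod4.overpartitionQuotient n (S k i) P (S-genFun k i) in
  ∣⇒∣ᵤ (≡.subst (+ 4 Signed.∣_) (≡.sym (Truncation.coeff S≈ ℕ.≤-refl))
    (∣m∣n⇒∣m+n (∣m∣n⇒∣m+n 4∣P (2∣x⇒4∣x+x 2∣P*squares)) (4∣x+x+[x+x] (t n))))
  where
  open OverpartitionsMod4 n using (squares)
  open Support n

  c = (k ∸ i) % 9
  P = TripleProductSupport.tripleProduct n k-1 i i≤k

  c%3≡2 : c % 3 ≡ 2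
  c%3≡2 = ≡.trans (m∣n⇒o%n%m≡o%m 3 9 (k ∸ i) (ℕ.divides 3 refl)) (∸%3≡2 {k} i≤k k%3≡2 i%3≡0)

  n≢square+exponent : ∀ a M r → ¬ a * a + thetaExponent i k M r ≡ n
  n≢square+exponent a M r eq = n%9≢c (square+residues (m%n<n (k ∸ i) 9) c%3≡2 a
    (thetaExponent-residues {i} {k} i≤k i%3≡0 M r) eq n%3≡2)

  P-support : ∀ d → Supported d (λ j → ∃₂ λ M r → j ≡ thetaExponent i k M r) P
  P-support d = supported-0⇒ d (TripleProductSupport.supported-tripleProduct n k-1 i i≤k)

  squares-support : Supported (+ 2) (λ j → ∃ λ a → j ≡ a * a) squares
  squares-support = supported-∑ (+ 2) (suc n) λ a →
    supported-⊆ (+ 2) (λ _ eq → suc a , eq) (supported-q^ (+ 2) (suc a * suc a))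

  4∣P : + 4 Signed.∣ P n
  -- An exponent by itself is the case of the square 0.
  4∣P = unsupported (+ 4) (P-support (+ 4)) ℕ.≤-refl
    λ { (M , r , eq) → n≢square+exponent 0 M r (≡.sym eq) }

  2∣P*squares : + 2 Signed.∣ (P *ₛ squares) n
  2∣P*squares = unsupported (+ 2) (supported-* (+ 2) (P-support (+ 2)) squares-support) ℕ.≤-refl
    λ { (e , _ , eq , (M , r , refl) , a , refl) →
        n≢square+exponent a M r (≡.trans (ℕ.+-comm (a * a) e) eq) }

mainTheorem4 : ∀ (k i : ℕ) → 1 ≤ i → 2 * i ≤ k → k % 3 ≡ 2 → i % 3 ≡ 0 → ∀ (n : ℕ) →
    ((k ∸ i) % 9 ≡ 2 → (+ 4 ∣ S k i (9 * n + 5)) × (+ 4 ∣ S k i (9 * n + 8))) ×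
    ((k ∸ i) % 9 ≡ 5 → (+ 4 ∣ S k i (9 * n + 2)) × (+ 4 ∣ S k i (9 * n + 8))) ×
    ((k ∸ i) % 9 ≡ 8 → (+ 4 ∣ S k i (9 * n + 2)) × (+ 4 ∣ S k i (9 * n + 5)))
mainTheorem4 k i _ 2i≤k k%3≡2 i%3≡0 n =
  -- The residues 2, 5, 8 are those that are 2 modulo 3; in each case the two different from k - i
  -- remain.
  (λ c≡2 → 4∣S[9n+ 5 ] refl c≡2 (λ ()) , 4∣S[9n+ 8 ] refl c≡2 (λ ())) ,
  (λ c≡5 → 4∣S[9n+ 2 ] refl c≡5 (λ ()) , 4∣S[9n+ 8 ] refl c≡5 (λ ())) ,
  (λ c≡8 → 4∣S[9n+ 2 ] refl c≡8 (λ ()) , 4∣S[9n+ 5 ] refl c≡8 (λ ()))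
  where
  i≤k : i ≤ k
  i≤k = ℕ.≤-trans (ℕ.m≤m+n i (i + 0)) 2i≤k

  [9n+r]%9 : ∀ r → (9 * n + r) % 9 ≡ r % 9
  [9n+r]%9 r = ≡.trans (cong (_% 9) (≡.trans (ℕ.+-comm (9 * n) r) (cong (λ x → r + x) (ℕ.*-comm 9 n))))
    ([m+kn]%n≡m%n r n 9)

  4∣S[9n+_] : ∀ r {c} → r % 9 % 3 ≡ 2 → (k ∸ i) % 9 ≡ c → ¬ r % 9 ≡ c → + 4 ∣ S k i (9 * n + r)
  4∣S[9n+ r ] r%3≡2 refl r≢c = 4∣S k i i≤k k%3≡2 i%3≡0 (9 * n + r)
    (≡.trans (≡.sym (m∣n⇒o%n%m≡o%m 3 9 (9 * n + r) (ℕ.divides 3 refl)))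
      (≡.trans (cong (_% 3) ([9n+r]%9 r)) r%3≡2))
    (r≢c ∘ ≡.trans (≡.sym ([9n+r]%9 r)))
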